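{- Let $V$ be the set of integer points $(x,y,z)\in\mathbb{Z}^3$ such that none of $x+y,\ x-y,\ y+z,\ y-z,\ z+x,\ z-x$ is congruent to $0 \pmod 4$, let $G$ be the graph with vertex set $V$ in which two vertices are adjacent exactly when their Euclidean distance is $\sqrt{2}$, let $O=(0,1,2)$, and for $P\in V$ let $\operatorname{dis}(P)$ be the graph distance in $G$ from $O$ to $P$. For an integer $n\ge 0$ let $$S(n)=\#\{P\in V:\operatorname{dis}(P)=n\},\qquad \bar S(n)=\#\{P=(x,y,z)\in V:\operatorname{dis}(P)=n,\ xyz=0\}.$$ Then $\bar S(0)=1$ and $\bar S(n)=4n$ for $n>0$; and $S(0)=1$ and $S(n)=2(n^2+1)$ for $n>0$.
   Context: $G$ is the sodalite network: the edge-skeleton of the uniform tiling of Euclidean 3-space by truncated octahedra, scaled by a factor 4; each vertex has four neighbours. $S(n)$ is the coordination sequence of this network, and $\bar S(n)$ counts the vertices at height $n$ lying on the coordinate planes. -}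

module Defs where

open import Data.Integer.Base using (ℤ; +_; _+_; _-_; _*_; _^_)
open import Data.Integer.Divisibility using (_∣_)
open import Data.List.Base using (List; length)
open import Data.List.Membership.Propositional using (_∈_)
open import Data.List.Relation.Unary.Unique.Propositional using (Unique)
open import Data.Nat.Base using (ℕ; zero; suc; _≤_)
open import Data.Nat.Divisibility using (_∣?_)
open import Data.Product.Base using (∃-syntax; _×_; _,_)
open import Function.Bundles using (_⇔_)
open import Level using (Level; 0ℓ)
open import Relation.Binary.Core using (Rel)
open import Relation.Binary.PropositionalEquality.Core using (_≡_)
open import Relation.Nullary.Decidable.Core using (from-no)
open import Relation.Nullary.Negation.Core using (¬_)
open import Relation.Unary using (Pred)

private
  variable
    a r p : Level

data Walk {A : Set a} (R : Rel A r) (u : A) : A → ℕ → Set (a Level.⊔ r) where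
  start : Walk R u u zero
  step  : ∀ {v w n} → Walk R u v n → R v w → Walk R u w (suc n)

-- A relation rather than a function: vertices in different components have
-- no distance.
IsDistance : {A : Set a} → Rel A r → A → A → ℕ → Set (a Level.⊔ r)
IsDistance R u v n = Walk R u v n × (∀ m → Walk R u v m → n ≤ m)

HasCardinality : {A : Set a} → Pred A p → ℕ → Set (a Level.⊔ p)
HasCardinality {A = A} P n =
  ∃[ xs ] Unique {A = A} xs × (∀ v → v ∈ xs ⇔ P v) × length xs ≡ n

≡0mod4 : ℤ → Set
≡0mod4 i = + 4 ∣ i

InV : ℤ → ℤ → ℤ → Set
InV x y z =
    ¬ ≡0mod4 (x + y) × ¬ ≡0mod4 (x - y)
  × ¬ ≡0mod4 (y + z) × ¬ ≡0mod4 (y - z)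
  × ¬ ≡0mod4 (z + x) × ¬ ≡0mod4 (z - x)

-- The membership proof is irrelevant, so propositional equality of vertices
-- is equality of coordinates.
record V : Set where
  constructor vertex
  field
    x y z : ℤ
    .inV  : InV x y z

distanceSquared : V → V → ℤ
distanceSquared P Q = (P.x - Q.x) ^ 2 + (P.y - Q.y) ^ 2 + (P.z - Q.z) ^ 2
  where
  module P = V P
  module Q = V Q

-- Euclidean distance √2, squared to stay within the integers.
Adjacent : Rel V 0ℓ
Adjacent P Q = distanceSquared P Q ≡ + 2

O : V
O = vertex (+ 0) (+ 1) (+ 2)
  ( from-no (4 ∣? 1) , from-no (4 ∣? 1)
  , from-no (4 ∣? 3) , from-no (4 ∣? 1)
  , from-no (4 ∣? 2) , from-no (4 ∣? 2) )

Sphere : ℕ → Pred V 0ℓ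
Sphere n P = IsDistance Adjacent O P n

PlanarSphere : ℕ → Pred V 0ℓ
PlanarSphere n P = Sphere n P × V.x P * V.y P * V.z P ≡ + 0

{-# OPTIONS --safe #-}
module Submission where

-- V is the orbit of O under the affine Weyl group of type A₃, whose mirrors are the
-- planes on which one of the six forms y ± x, z ± y, z ± x is a multiple of 4.
-- An edge crosses exactly one mirror, and a point other than O is brought closer to O
-- by reflection in some wall of the alcove of O; so the distance from O to P is the
-- number of mirrors separating them.  Read as an affine permutation, P has one
-- inversion per separating mirror, and counting the inversions by the position where
-- they start gives the inversion table of Björner and Brenti: a bijection from V to the
-- quadruples of naturals containing a zero, under which the distance becomes the sum.
-- Counting by the position of the first zero, the generating function of S is
-- (1 + q + q² + q³)/(1 - q)³.
--
-- The planar vertices are permuted by the finite group of reflections in the mirrors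
-- y ± x = 0 and z = y.  Unfolding its fundamental chamber one mirror at a time reduces
-- the count to the points (0, y, z) with 0 < y < z, which the translations by (0, 4, 4)
-- and (0, 0, 4) generate from four of them.

open import Defs
open import Data.Empty using (⊥; ⊥-elim; ⊥-elim-irr)
open import Data.Integer.Base using (ℤ; +_; -[1+_]; 0ℤ; -_; ∣_∣; +<+; -<+; +≤+; -≤+; -≤-)
  renaming (_+_ to _+ᶻ_; _-_ to _-ᶻ_; _*_ to _*ᶻ_; _^_ to _^ᶻ_; _<_ to _<ᶻ_; _≤_ to _≤ᶻ_)
import Data.Integer.Divisibility.Signed as Signed
import Data.Integer.Properties as ℤ
open import Data.Integer.Tactic.RingSolver using () renaming (solve-∀ to ring)
open import Data.List.Base using ([]; _∷_; _++_; map)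
open import Data.List.Membership.Propositional.Properties
  using (∈-++⁺ˡ; ∈-++⁺ʳ; ∈-++⁻; ∈-map⁺; ∈-map⁻)
open import Data.List.Properties using (length-++; length-map)
open import Data.List.Relation.Unary.All using ([])
open import Data.List.Relation.Unary.AllPairs using ([]; _∷_)
open import Data.List.Relation.Unary.Any using (here; there)
open import Data.List.Relation.Unary.Unique.Propositional.Properties using (map⁺; ++⁺)
open import Data.Nat.Base
open import Data.Nat.Divisibility using (_∣_; _∣?_; divides; ∣-refl)
open import Data.Nat.DivMod using (_/_; /-monoˡ-≤; m/n*n≤m; m*n/n≡m; +-distrib-/-∣ʳ)
open import Data.Nat.Induction using (<-rec)
open import Data.Nat.Properties
open import Data.Nat.Tactic.RingSolver using () renaming (solve-∀ to ringℕ)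
open import Data.Product.Base using (∃-syntax; _×_; _,_; proj₁; proj₂; swap)
open import Data.Sum.Base using (_⊎_; inj₁; inj₂; [_,_]; map₂)
open import Data.Unit.Base using (⊤; tt)
open import Data.Vec.Base using (Vec; []; _∷_; sum; head; tail)
open import Data.Vec.Properties using (∷-injectiveʳ)
open import Data.Vec.Relation.Unary.Any using (Any; here; there)
open import Function.Base using (_∘_; const)
open import Function.Bundles using (mk⇔; Equivalence)
open import Function.Definitions using (Injective)
open import Level using (0ℓ)
open import Relation.Binary.Core using (Rel)
open import Relation.Binary.Definitions using (tri<; tri≈; tri>)
open import Relation.Binary.PropositionalEquality hiding ([_])
open import Relation.Nullary.Decidable.Core using (from-no)
open import Relation.Nullary.Negation.Core using (¬_; contradiction)
open import Relation.Unary using (Pred; _∪_; _⊆_; _≐_; ∅; U)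

open Equivalence using (to; from)

private
  variable
    A B : Set
    P Q X Y Z : Pred A 0ℓ
    f g : ℕ → ℕ

-- Counting in graded sets

Image : (B → A) → Pred B 0ℓ → Pred A 0ℓ
Image φ X a = ∃[ b ] X b × φ b ≡ a

card-resp : ∀ {n} → P ≐ Q → HasCardinality P n → HasCardinality Q n
card-resp (P⊆Q , Q⊆P) (xs , xs! , xs≡P , len) =
  xs , xs! , (λ v → mk⇔ (P⊆Q ∘ to (xs≡P v)) (from (xs≡P v) ∘ Q⊆P)) , len

card-∅ : (∀ a → ¬ P a) → HasCardinality P 0
card-∅ ¬P = [] , [] , (λ v → mk⇔ (λ ()) (⊥-elim ∘ ¬P v)) , refl

card-singleton : ∀ {a} → P ≐ (a ≡_) → HasCardinality P 1
card-singleton {a = a} (P⊆a , a⊆P) =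
  (a ∷ []) , ([] ∷ []) ,
  (λ v → mk⇔ (λ { (here v≡a) → a⊆P (sym v≡a) ; (there ()) }) (λ Pv → here (sym (P⊆a Pv)))) , refl

card-∪ : ∀ {m n} → (∀ {a} → P a → ¬ Q a) →
         HasCardinality P m → HasCardinality Q n → HasCardinality (P ∪ Q) (m + n)
card-∪ disj (xs , xs! , xs≡P , refl) (ys , ys! , ys≡Q , refl) =
  xs ++ ys ,
  ++⁺ xs! ys! (λ { {v} (v∈xs , v∈ys) → disj (to (xs≡P v) v∈xs) (to (ys≡Q v) v∈ys) }) ,
  (λ v → mk⇔ ([ inj₁ ∘ to (xs≡P v) , inj₂ ∘ to (ys≡Q v) ] ∘ ∈-++⁻ xs)
             [ ∈-++⁺ˡ ∘ from (xs≡P v) , ∈-++⁺ʳ xs ∘ from (ys≡Q v) ]) ,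
  length-++ xs

card-Image : ∀ {n} {φ : A → B} → Injective _≡_ _≡_ φ →
             HasCardinality P n → HasCardinality (Image φ P) n
card-Image {φ = φ} inj (xs , xs! , xs≡P , refl) =
  map φ xs , map⁺ inj xs! ,
  (λ v → mk⇔ (λ v∈ → let a , a∈ , v≡ = ∈-map⁻ φ v∈ in a , to (xs≡P a) a∈ , sym v≡)
             (λ { (a , Pa , refl) → ∈-map⁺ φ (from (xs≡P a) Pa) })) ,
  length-map φ xs

Counted : (A → ℕ) → Pred A 0ℓ → (ℕ → ℕ) → Set
Counted w X f = ∀ n → HasCardinality (λ a → X a × w a ≡ n) (f n)

-- On generating functions this is multiplication by q^k.
shift : ℕ → (ℕ → ℕ) → ℕ → ℕ
shift zero    f n       = f n
shift (suc k) f zero    = 0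
shift (suc k) f (suc n) = shift k f n

private
  variable
    w w′ : A → ℕ

shift-cases : ∀ k n → (∃[ m ] k + m ≡ n × (∀ f → shift k f n ≡ f m)) ⊎
                      ((∀ m → k + m ≢ n) × (∀ f → shift k f n ≡ 0))
shift-cases zero    n       = inj₁ (n , refl , λ f → refl)
shift-cases (suc k) zero    = inj₂ ((λ m ()) , λ f → refl)
shift-cases (suc k) (suc n) with shift-cases k n
... | inj₁ (m , eq , sh) = inj₁ (m , cong suc eq , sh)
... | inj₂ (ne , sh)     = inj₂ ((λ m → ne m ∘ suc-injective) , sh)

-- The combinatorial form of an equation X = Y + q^k Z between generating functions. `Z` may be `X`
-- itself, which makes the equation recursive.
record Splits (w : A → ℕ) (X Y : Pred A 0ℓ) (w′ : B → ℕ) (φ : B → A) (Z : Pred B 0ℓ) (k : ℕ) : Set where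
  field
    injective : Injective _≡_ _≡_ φ
    weight    : ∀ {b} → Z b → w (φ b) ≡ k + w′ b
    sound     : Y ∪ Image φ Z ⊆ X
    complete  : X ⊆ Y ∪ Image φ Z
    disjoint  : ∀ {b} → Z b → ¬ Y (φ b)

module _ {k} {φ : B → A} (s : Splits w X Y w′ φ Z k) where
  open Splits s

  private
    slice : ∀ n → (λ a → X a × w a ≡ n) ≐
                  (λ a → Y a × w a ≡ n) ∪ Image φ (λ b → Z b × k + w′ b ≡ n)
    slice n =
      (λ { (Xa , refl) → [ (λ Ya → inj₁ (Ya , refl))
                         , (λ { (b , Zb , refl) → inj₂ (b , (Zb , sym (weight Zb)) , refl) }) ] (complete Xa) }) ,
      [ (λ { (Ya , wa) → sound (inj₁ Ya) , wa })
      , (λ { (b , (Zb , wb) , refl) → sound (inj₂ (b , Zb , refl)) , trans (weight Zb) wb }) ]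

    part : ∀ n → (∀ m → k + m ≡ n → HasCardinality (λ b → Z b × w′ b ≡ m) (f m)) →
           HasCardinality (λ b → Z b × k + w′ b ≡ n) (shift k f n)
    part {f} n IH with shift-cases k n
    ... | inj₁ (m , refl , sh) rewrite sh f =
      card-resp ((λ { (Zb , eq) → Zb , cong (_+_ k) eq }) ,
                 (λ { (Zb , eq) → Zb , +-cancelˡ-≡ k _ _ eq })) (IH m refl)
    ... | inj₂ (ne , sh) rewrite sh f = card-∅ (λ { b (_ , eq) → ne _ eq })

  -- The count of `Z` is requested only at the degree m with k + m = n, so that an induction
  -- hypothesis can supply it.
  card-split : ∀ n → Counted w Y g →
    (∀ m → k + m ≡ n → HasCardinality (λ b → Z b × w′ b ≡ m) (f m)) →
    HasCardinality (λ a → X a × w a ≡ n) (g n + shift k f n)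
  card-split n cY IH = card-resp (swap (slice n))
    (card-∪ (λ { (Ya , _) (b , (Zb , _) , refl) → disjoint Zb Ya })
      (cY n) (card-Image injective (part n IH)))

  counted-split : Counted w Y g → Counted w′ Z f → Counted w X (λ n → g n + shift k f n)
  counted-split cY cZ n = card-split n cY (λ m _ → cZ m)

-- The case Z = X, that is, X = Y / (1 - q^(k+1)). The shift by `suc k` makes the recursive call go
-- to a strictly smaller weight.
counted-rec : ∀ {k} {φ : A → A} → Splits w X Y w φ X (suc k) → Counted w Y g →
  (∀ n → f n ≡ g n + shift (suc k) f n) → Counted w X f
counted-rec {w = w} {X = X} {f = f} {k = k} s cY rec =
  <-rec (λ n → HasCardinality (λ a → X a × w a ≡ n) (f n)) λ n IH →
    subst (HasCardinality _) (sym (rec n))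
      (card-split s n cY λ { m refl → IH (m<n+m m (s≤s z≤n)) })

counted-resp : X ≐ Y → f ≗ g → Counted w X f → Counted w Y g
counted-resp (X⊆Y , Y⊆X) f≗g c n =
  subst (HasCardinality _) (f≗g n)
    (card-resp ((λ { (Xa , wa) → X⊆Y Xa , wa }) , (λ { (Ya , wa) → Y⊆X Ya , wa })) (c n))

counted-∪ : (∀ {a} → X a → ¬ Y a) → Counted w X f → Counted w Y g → Counted w (X ∪ Y) (λ n → f n + g n)
counted-∪ disj cX cY n = card-resp
  ([ (λ { (Xa , wa) → inj₁ Xa , wa }) , (λ { (Ya , wa) → inj₂ Ya , wa }) ] ,
   (λ { (inj₁ Xa , wa) → inj₁ (Xa , wa) ; (inj₂ Ya , wa) → inj₂ (Ya , wa) }))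
  (card-∪ (λ { (Xa , _) (Ya , _) → disj Xa Ya }) (cX n) (cY n))

δ : ℕ → ℕ
δ zero    = 1
δ (suc n) = 0

counted-∅ : Counted {A} w ∅ (const 0)
counted-∅ n = card-∅ (λ { _ (() , _) })

counted-singleton : ∀ {a : A} → Counted w (a ≡_) (shift (w a) δ)
counted-singleton {w = w} {a = a} n with shift-cases (w a) n
... | inj₁ (zero , eq , sh) rewrite sh δ =
  card-singleton (proj₁ , λ { refl → refl , trans (sym (+-identityʳ _)) eq })
... | inj₁ (suc m , refl , sh) rewrite sh δ =
  card-∅ (λ { _ (refl , eq) → contradiction (trans eq (+-suc _ m)) (λ e → m≢1+m+n _ e) })
  where open import Data.Nat.Properties using (m≢1+m+n)
... | inj₂ (ne , sh) rewrite sh δ =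
  card-∅ (λ { _ (refl , eq) → ne 0 (trans (+-identityʳ _) eq) })

-- The coefficients of 1 / (1 - q)^k, by the recursion (1 - q) F(k+1) = F(k).
compositions : ℕ → ℕ → ℕ
compositions zero    n       = δ n
compositions (suc k) zero    = compositions k zero
compositions (suc k) (suc n) = compositions k (suc n) + compositions (suc k) n

counted-Vec : ∀ k → Counted (sum {k}) U (compositions k)
counted-Vec zero    = counted-resp ((λ _ → _) , λ { {[]} _ → refl }) (λ _ → refl) counted-singleton
counted-Vec (suc k) = counted-rec bump
  (counted-split zeroHead counted-∅ (counted-Vec k))
  λ { zero → sym (+-identityʳ _) ; (suc n) → refl }
  where
  ZeroHead : Pred (Vec ℕ (suc k)) 0ℓ
  ZeroHead = Image (0 ∷_) U

  zeroHead : Splits sum ZeroHead ∅ sum (0 ∷_) U 0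
  zeroHead = record
    { injective = ∷-injectiveʳ
    ; weight    = λ _ → refl
    ; sound     = λ { (inj₂ z) → z }
    ; complete  = inj₂
    ; disjoint  = λ _ ()
    }

  bump : Splits sum U ZeroHead sum (λ { (p ∷ v) → suc p ∷ v }) U 1
  bump = record
    { injective = λ { {_ ∷ _} {_ ∷ _} refl → refl }
    ; weight    = λ { {_ ∷ _} _ → refl }
    ; sound     = λ _ → _
    ; complete  = λ { {zero ∷ v} _ → inj₁ (v , _ , refl) ; {suc p ∷ v} _ → inj₂ (p ∷ v , _ , refl) }
    ; disjoint  = λ { {_ ∷ _} _ (_ , _ , ()) }
    }

-- Reflections and inversion tables

-- The number of multiples m of 4 with v < m ≤ 0.
below : ℤ → ℕ
below (+ n)    = 0
below -[1+ n ] = suc (n / 4)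

below-antitone : ∀ {v w} → v ≤ᶻ w → below w ≤ below v
below-antitone (-≤- n≤m) = s≤s (/-monoˡ-≤ 4 n≤m)
below-antitone -≤+       = z≤n
below-antitone (+≤+ _)   = z≤n

below-positive : ∀ {v} → 0ℤ <ᶻ v → below v ≡ 0
below-positive (+<+ _) = refl

[n+4]/4 : ∀ n → (n + 4) / 4 ≡ suc (n / 4)
[n+4]/4 n = trans (+-distrib-/-∣ʳ n ∣-refl) (+-comm (n / 4) 1)

-- Exactly one multiple of 4 lies in the interval from v - 3 to v, and v < 4 makes it at most 0, so
-- that it is counted.
below-4 : ∀ {v} → v <ᶻ + 4 → below (v -ᶻ + 4) ≡ suc (below v)
below-4 { + 0} _ = refl
below-4 { + 1} _ = refl
below-4 { + 2} _ = refl
below-4 { + 3} _ = refl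
below-4 { + suc (suc (suc (suc n)))} (+<+ (s≤s (s≤s (s≤s (s≤s ())))))
below-4 { -[1+ n ]} _ = cong suc (trans (cong (_/ 4) (sym (+-suc n 3))) ([n+4]/4 n))

below-≤4 : ∀ v → below (v -ᶻ + 4) ≤ suc (below v)
below-≤4 (+ 0) = ≤-refl
below-≤4 (+ 1) = ≤-refl
below-≤4 (+ 2) = ≤-refl
below-≤4 (+ 3) = ≤-refl
below-≤4 (+ suc (suc (suc (suc n)))) = z≤n
below-≤4 v@(-[1+ n ]) = ≤-reflexive (below-4 { v} -<+)

below-1 : ∀ v → below (v -ᶻ + 1) ≤ suc (below v)
below-1 v = ≤-trans (below-antitone (ℤ.+-monoʳ-≤ v (-≤- {3} {0} z≤n))) (below-≤4 v)

-- The only multiple of 4 that could be gained by this unit step is `v` itself.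
below-1-regular : ∀ {v} → ¬ ≡0mod4 v → below (v -ᶻ + 1) ≤ below v
below-1-regular { + 0} ¬4∣v = contradiction (divides 0 refl) ¬4∣v
below-1-regular { + suc n} ¬4∣v = z≤n
below-1-regular { -[1+ n ]} ¬4∣v rewrite +-identityʳ n = s≤s (lemma (suc n) ¬4∣v)
  where
  lemma : ∀ m → ¬ 4 ∣ m → m / 4 ≤ pred m / 4
  lemma m ¬4∣m = ≤-trans (≤-reflexive (sym (m*n/n≡m (m / 4) 4))) (/-monoˡ-≤ 4 (<⇒≤pred
    (≤∧≢⇒< (m/n*n≤m m 4) (λ eq → ¬4∣m (divides (m / 4) (sym eq))))))

-- A bound for the growth of below along a displacement from a point that is not
-- a multiple of 4.
cost : ℤ → ℕ
cost (+ n)    = 0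
cost -[1+ n ] = n

-- The first unit step down is free by `below-1-regular`; each further one gains at most one
-- multiple. This is sharp enough for edges, along which a form changes by at most 2.
below-cost : ∀ {v} → ¬ ≡0mod4 v → ∀ e → below (v +ᶻ e) ≤ cost e + below v
below-cost {v} _    (+ n)          = below-antitone (ℤ.i≤i+j v (+ n))
below-cost     ¬4∣v -[1+ zero ]    = below-1-regular ¬4∣v
below-cost {v} ¬4∣v -[1+ suc n ]   =
  ≤-trans (subst (λ w → below w ≤ suc (below (v +ᶻ -[1+ n ])))
            (trans (ℤ.+-assoc v -[1+ n ] -[1+ 0 ]) (cong (λ k → v +ᶻ -[1+ suc k ]) (+-identityʳ n)))
            (below-1 (v +ᶻ -[1+ n ])))
    (s≤s (below-cost ¬4∣v -[1+ n ]))

-- Symmetries of the vertex set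

¬0mod4-translate : ∀ {i} j k → i ≡ j +ᶻ k *ᶻ + 4 → ¬ ≡0mod4 i → ¬ ≡0mod4 j
¬0mod4-translate {i} j k refl ¬4∣i 4∣j =
  ¬4∣i (Signed.∣⇒∣ᵤ { + 4} {i} (Signed.∣m∣n⇒∣m+n (Signed.∣ᵤ⇒∣ { + 4} {j} 4∣j) (Signed.divides k refl)))

¬0mod4-reflect : ∀ {i} j k → i ≡ - j +ᶻ k *ᶻ + 4 → ¬ ≡0mod4 i → ¬ ≡0mod4 j
¬0mod4-reflect {i} j k refl ¬4∣i 4∣j =
  ¬4∣i (Signed.∣⇒∣ᵤ { + 4} {i}
    (Signed.∣m∣n⇒∣m+n (Signed.∣m⇒∣-m (Signed.∣ᵤ⇒∣ { + 4} {j} 4∣j)) (Signed.divides k refl)))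

V-≡ : ∀ {x y z x′ y′ z′} → x ≡ x′ → y ≡ y′ → z ≡ z′ →
      .{p : InV x y z} .{q : InV x′ y′ z′} → vertex x y z p ≡ vertex x′ y′ z′ q
V-≡ refl refl refl = refl

-- Modulo 4 and up to sign, the map permutes the six forms.
InV-rotate : ∀ x y z → InV x y z → InV (z -ᶻ + 2) (+ 2 -ᶻ y) (+ 2 -ᶻ x)
InV-rotate x y z (x+y , x-y , y+z , y-z , z+x , z-x) =
    ¬0mod4-reflect   (x′ +ᶻ y′) (+ 0) (e₁ y z) y-z
  , ¬0mod4-translate (x′ -ᶻ y′) (+ 1) (e₂ y z) y+z
  , ¬0mod4-reflect   (y′ +ᶻ z′) (+ 1) (e₃ x y) x+y
  , ¬0mod4-translate (y′ -ᶻ z′) (+ 0) (e₄ x y) x-y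
  , ¬0mod4-translate (z′ +ᶻ x′) (+ 0) (e₅ x z) z-x
  , ¬0mod4-reflect   (z′ -ᶻ x′) (+ 1) (e₆ x z) z+x
  where
  x′ = z -ᶻ + 2
  y′ = + 2 -ᶻ y
  z′ = + 2 -ᶻ x
  e₁ : ∀ y z → y -ᶻ z ≡ - ((z -ᶻ + 2) +ᶻ (+ 2 -ᶻ y)) +ᶻ + 0 *ᶻ + 4
  e₁ = ring
  e₂ : ∀ y z → y +ᶻ z ≡ ((z -ᶻ + 2) -ᶻ (+ 2 -ᶻ y)) +ᶻ + 1 *ᶻ + 4
  e₂ = ring
  e₃ : ∀ x y → x +ᶻ y ≡ - ((+ 2 -ᶻ y) +ᶻ (+ 2 -ᶻ x)) +ᶻ + 1 *ᶻ + 4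
  e₃ = ring
  e₄ : ∀ x y → x -ᶻ y ≡ ((+ 2 -ᶻ y) -ᶻ (+ 2 -ᶻ x)) +ᶻ + 0 *ᶻ + 4
  e₄ = ring
  e₅ : ∀ x z → z -ᶻ x ≡ ((+ 2 -ᶻ x) +ᶻ (z -ᶻ + 2)) +ᶻ + 0 *ᶻ + 4
  e₅ = ring
  e₆ : ∀ x z → z +ᶻ x ≡ - ((+ 2 -ᶻ x) -ᶻ (z -ᶻ + 2)) +ᶻ + 1 *ᶻ + 4
  e₆ = ring

InV-reflect : ∀ x y z → InV x y z → InV (- y) (- x) z
InV-reflect x y z (x+y , x-y , y+z , y-z , z+x , z-x) =
    ¬0mod4-reflect   (- y +ᶻ - x) (+ 0) (e₁ x y) x+y
  , ¬0mod4-translate (- y -ᶻ - x) (+ 0) (e₂ x y) x-y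
  , ¬0mod4-translate (- x +ᶻ z)   (+ 0) (e₃ x z) z-x
  , ¬0mod4-reflect   (- x -ᶻ z)   (+ 0) (e₄ x z) z+x
  , ¬0mod4-reflect   (z +ᶻ - y)   (+ 0) (e₅ y z) y-z
  , ¬0mod4-translate (z -ᶻ - y)   (+ 0) (e₆ y z) y+z
  where
  e₁ : ∀ x y → x +ᶻ y ≡ - (- y +ᶻ - x) +ᶻ + 0 *ᶻ + 4
  e₁ = ring
  e₂ : ∀ x y → x -ᶻ y ≡ (- y -ᶻ - x) +ᶻ + 0 *ᶻ + 4
  e₂ = ring
  e₃ : ∀ x z → z -ᶻ x ≡ (- x +ᶻ z) +ᶻ + 0 *ᶻ + 4
  e₃ = ring
  e₄ : ∀ x z → z +ᶻ x ≡ - (- x -ᶻ z) +ᶻ + 0 *ᶻ + 4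
  e₄ = ring
  e₅ : ∀ y z → y -ᶻ z ≡ - (z +ᶻ - y) +ᶻ + 0 *ᶻ + 4
  e₅ = ring
  e₆ : ∀ y z → y +ᶻ z ≡ (z -ᶻ - y) +ᶻ + 0 *ᶻ + 4
  e₆ = ring

-- The symmetry of V that fixes O and permutes the four walls of its alcove
-- cyclically; reflect is the reflection in one of these walls.
rotate : V → V
rotate (vertex x y z p) = vertex (z -ᶻ + 2) (+ 2 -ᶻ y) (+ 2 -ᶻ x) (InV-rotate x y z p)

rotate² rotate³ : V → V
rotate² = rotate ∘ rotate
rotate³ = rotate ∘ rotate²

rotate⁴ : ∀ P → rotate (rotate³ P) ≡ P
rotate⁴ (vertex x y z _) = V-≡ (e₁ x) (e₂ y) (e₃ z)
  where
  e₁ : ∀ x → + 2 -ᶻ (+ 2 -ᶻ x -ᶻ + 2) -ᶻ + 2 ≡ x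
  e₁ = ring
  e₂ : ∀ y → + 2 -ᶻ (+ 2 -ᶻ (+ 2 -ᶻ (+ 2 -ᶻ y))) ≡ y
  e₂ = ring
  e₃ : ∀ z → + 2 -ᶻ (+ 2 -ᶻ (z -ᶻ + 2) -ᶻ + 2) ≡ z
  e₃ = ring

reflect : V → V
reflect (vertex x y z p) = vertex (- y) (- x) z (InV-reflect x y z p)

reflect-involutive : ∀ P → reflect (reflect P) ≡ P
reflect-involutive (vertex x y z _) = V-≡ (ℤ.neg-involutive x) (ℤ.neg-involutive y) refl

-- Vanishes on the mirror of `reflect`. Composed with the powers of `rotate` it gives the four walls
-- of the alcove of `O`: y + x, z - y, y - x and 4 - (z + y).
α : V → ℤ
α (vertex x y z _) = y +ᶻ x

α-reflect : ∀ P → α (reflect P) ≡ - α P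
α-reflect (vertex x y z _) = e x y
  where
  e : ∀ x y → - x +ᶻ - y ≡ - (y +ᶻ x)
  e = ring

α≢0 : ∀ P → α P ≢ 0ℤ
α≢0 (vertex x y z p) eq = ⊥-elim-irr
  (proj₁ p (subst ≡0mod4 (trans (sym eq) (ℤ.+-comm y x)) (divides 0 refl)))

-- Inversion tables

below₃ : ℤ → ℤ → ℤ → ℕ
below₃ i j k = below i + (below j + below k)

below₃-cong : ∀ {i j k i′ j′ k′} → i ≡ i′ → j ≡ j′ → k ≡ k′ → below₃ i j k ≡ below₃ i′ j′ k′
below₃-cong refl refl refl = refl

-- At `O` all six forms lie strictly between 0 and 4, so each term counts the mirrors of one form
-- that separate P from `O` on its lower side. The three rotated copies supply the lower sides of
-- the other three forms and the upper sides of all six, so `distance` counts every separating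
-- mirror once.
inversions : V → ℕ
inversions (vertex x y z _) = below₃ (y +ᶻ x) (z +ᶻ x) (z +ᶻ y)

inversions-rotate : ∀ P → let open V P in inversions (rotate P) ≡
                    below₃ (z -ᶻ y) (z -ᶻ x) (+ 4 -ᶻ (y +ᶻ x))
inversions-rotate (vertex x y z _) = below₃-cong (e₁ y z) (e₁ x z) (e₂ x y)
  where
  e₁ : ∀ y z → (+ 2 -ᶻ y) +ᶻ (z -ᶻ + 2) ≡ z -ᶻ y
  e₁ = ring
  e₂ : ∀ x y → (+ 2 -ᶻ x) +ᶻ (+ 2 -ᶻ y) ≡ + 4 -ᶻ (y +ᶻ x)
  e₂ = ring

inversions-rotate² : ∀ P → let open V P in inversions (rotate² P) ≡
                     below₃ (y -ᶻ x) (+ 4 -ᶻ (z +ᶻ x)) (+ 4 -ᶻ (z -ᶻ y))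
inversions-rotate² P@(vertex x y z _) =
  trans (inversions-rotate (rotate P)) (below₃-cong (e₁ x y) (e₂ x z) (e₃ y z))
  where
  e₁ : ∀ x y → + 2 -ᶻ x -ᶻ (+ 2 -ᶻ y) ≡ y -ᶻ x
  e₁ = ring
  e₂ : ∀ x z → + 2 -ᶻ x -ᶻ (z -ᶻ + 2) ≡ + 4 -ᶻ (z +ᶻ x)
  e₂ = ring
  e₃ : ∀ y z → + 4 -ᶻ (+ 2 -ᶻ y +ᶻ (z -ᶻ + 2)) ≡ + 4 -ᶻ (z -ᶻ y)
  e₃ = ring

inversions-rotate³ : ∀ P → let open V P in inversions (rotate³ P) ≡
                     below₃ (+ 4 -ᶻ (z +ᶻ y)) (+ 4 -ᶻ (z -ᶻ x)) (+ 4 -ᶻ (y -ᶻ x))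
inversions-rotate³ P@(vertex x y z _) =
  trans (inversions-rotate² (rotate P)) (below₃-cong (e₁ y z) (e₂ x z) (e₃ x y))
  where
  e₁ : ∀ y z → + 2 -ᶻ y -ᶻ (z -ᶻ + 2) ≡ + 4 -ᶻ (z +ᶻ y)
  e₁ = ring
  e₂ : ∀ x z → + 4 -ᶻ (+ 2 -ᶻ x +ᶻ (z -ᶻ + 2)) ≡ + 4 -ᶻ (z -ᶻ x)
  e₂ = ring
  e₃ : ∀ x y → + 4 -ᶻ (+ 2 -ᶻ x -ᶻ (+ 2 -ᶻ y)) ≡ + 4 -ᶻ (y -ᶻ x)
  e₃ = ring

table : V → Vec ℕ 4
table P = inversions P ∷ inversions (rotate P) ∷ inversions (rotate² P) ∷ inversions (rotate³ P) ∷ []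

distance : V → ℕ
distance P = sum (table P)

rotl : Vec ℕ 4 → Vec ℕ 4
rotl (i ∷ j ∷ k ∷ l ∷ []) = j ∷ k ∷ l ∷ i ∷ []

table-rotate : ∀ P → table (rotate P) ≡ rotl (table P)
table-rotate P = cong
  (λ Q → inversions (rotate P) ∷ inversions (rotate² P) ∷ inversions (rotate³ P) ∷ inversions Q ∷ [])
  (rotate⁴ P)

sum-rotl : ∀ v → sum (rotl v) ≡ sum v
sum-rotl (i ∷ j ∷ k ∷ l ∷ []) = e i j k l
  where
  e : ∀ i j k l → j + (k + (l + (i + 0))) ≡ i + (j + (k + (l + 0)))
  e = ringℕ

distance-rotate : ∀ P → distance (rotate P) ≡ distance P
distance-rotate P = trans (cong sum (table-rotate P)) (sum-rotl (table P))

bump : Vec ℕ 4 → Vec ℕ 4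
bump (i ∷ j ∷ k ∷ l ∷ []) = suc j ∷ i ∷ k ∷ l ∷ []

sum-bump : ∀ v → sum (bump v) ≡ suc (sum v)
sum-bump (i ∷ j ∷ k ∷ l ∷ []) = e i j (k + (l + 0))
  where
  e : ∀ i j k → suc j + (i + k) ≡ suc (i + (j + k))
  e = ringℕ

below-neg : ∀ {v} → 0ℤ <ᶻ v → below (- v) ≡ suc (below (+ 4 -ᶻ v))
below-neg {v} 0<v = trans (cong below (e v)) (below-4 4-v<4)
  where
  e : ∀ v → - v ≡ + 4 -ᶻ v -ᶻ + 4
  e = ring
  4-v<4 : + 4 -ᶻ v <ᶻ + 4
  4-v<4 = ℤ.+-monoʳ-< (+ 4) (ℤ.neg-mono-< 0<v)

below-4+ : ∀ {v} → 0ℤ <ᶻ v → below (+ 4 +ᶻ v) ≡ 0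
below-4+ (+<+ _) = refl

-- The reflection negates y + x, fixes y - x, and exchanges z + x with z - y and z + y with z - x.
-- The first two entries thus trade their forms, while the last two keep theirs; crossing the mirror
-- y + x = 0 accounts for the extra one.
table-reflect : ∀ P → 0ℤ <ᶻ α P → table (reflect P) ≡ bump (table P)
table-reflect P@(vertex x y z _) 0<α = cong₄
  (begin
    below₃ (- x +ᶻ - y) (z -ᶻ y) (z -ᶻ x)
      ≡⟨ cong (_+ below₂) (trans (cong below (α-reflect P)) (below-neg 0<α)) ⟩
    suc (below (+ 4 -ᶻ (y +ᶻ x)) + below₂)
      ≡⟨ cong suc (rotate₃ (below (+ 4 -ᶻ (y +ᶻ x))) (below (z -ᶻ y)) (below (z -ᶻ x))) ⟩
    suc (below₃ (z -ᶻ y) (z -ᶻ x) (+ 4 -ᶻ (y +ᶻ x)))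
      ≡⟨ cong suc (inversions-rotate P) ⟨
    suc (inversions (rotate P)) ∎)
  (begin
    inversions (rotate (reflect P))
      ≡⟨ inversions-rotate (reflect P) ⟩
    below₃ (z -ᶻ - x) (z -ᶻ - y) (+ 4 -ᶻ (- x +ᶻ - y))
      ≡⟨ below₃-cong (z--x x) (z--x y) (e₁ x y) ⟩
    below₃ (z +ᶻ x) (z +ᶻ y) (+ 4 +ᶻ (y +ᶻ x))
      -- Both of the exchanged counts are zero, since y + x is positive.
      ≡⟨ cong (λ n → below (z +ᶻ x) + (below (z +ᶻ y) + n)) (trans (below-4+ 0<α) (sym (below-positive 0<α))) ⟩
    below₃ (z +ᶻ x) (z +ᶻ y) (y +ᶻ x)
      ≡⟨ rotate₃ (below (y +ᶻ x)) (below (z +ᶻ x)) (below (z +ᶻ y)) ⟨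
    below₃ (y +ᶻ x) (z +ᶻ x) (z +ᶻ y) ∎)
  (begin
    inversions (rotate² (reflect P))
      ≡⟨ inversions-rotate² (reflect P) ⟩
    below₃ (- x -ᶻ - y) (+ 4 -ᶻ (z +ᶻ - y)) (+ 4 -ᶻ (z -ᶻ - x))
      ≡⟨ below₃-cong (e₂ x y) (refl {x = + 4 -ᶻ (z -ᶻ y)}) (cong (+ 4 -ᶻ_) (z--x x)) ⟩
    below₃ (y -ᶻ x) (+ 4 -ᶻ (z -ᶻ y)) (+ 4 -ᶻ (z +ᶻ x))
      ≡⟨ cong (_+_ (below (y -ᶻ x))) (+-comm (below (+ 4 -ᶻ (z -ᶻ y))) _) ⟩
    below₃ (y -ᶻ x) (+ 4 -ᶻ (z +ᶻ x)) (+ 4 -ᶻ (z -ᶻ y))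
      ≡⟨ inversions-rotate² P ⟨
    inversions (rotate² P) ∎)
  (begin
    inversions (rotate³ (reflect P))
      ≡⟨ inversions-rotate³ (reflect P) ⟩
    below₃ (+ 4 -ᶻ (z +ᶻ - x)) (+ 4 -ᶻ (z -ᶻ - y)) (+ 4 -ᶻ (- x -ᶻ - y))
      ≡⟨ below₃-cong (refl {x = + 4 -ᶻ (z -ᶻ x)}) (cong (+ 4 -ᶻ_) (z--x y)) (cong (+ 4 -ᶻ_) (e₂ x y)) ⟩
    below₃ (+ 4 -ᶻ (z -ᶻ x)) (+ 4 -ᶻ (z +ᶻ y)) (+ 4 -ᶻ (y -ᶻ x))
      ≡⟨ swap₃ (below (+ 4 -ᶻ (z -ᶻ x))) (below (+ 4 -ᶻ (z +ᶻ y))) (below (+ 4 -ᶻ (y -ᶻ x))) ⟩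
    below₃ (+ 4 -ᶻ (z +ᶻ y)) (+ 4 -ᶻ (z -ᶻ x)) (+ 4 -ᶻ (y -ᶻ x))
      ≡⟨ inversions-rotate³ P ⟨
    inversions (rotate³ P) ∎)
  where
  open ≡-Reasoning

  cong₄ : ∀ {i j k l i′ j′ k′ l′ : ℕ} → i ≡ i′ → j ≡ j′ → k ≡ k′ → l ≡ l′ →
          _≡_ {A = Vec ℕ 4} (i ∷ j ∷ k ∷ l ∷ []) (i′ ∷ j′ ∷ k′ ∷ l′ ∷ [])
  cong₄ refl refl refl refl = refl

  below₂ = below (z -ᶻ y) + below (z -ᶻ x)

  rotate₃ : ∀ i j k → i + (j + k) ≡ j + (k + i)
  rotate₃ = ringℕ
  swap₃ : ∀ i j k → i + (j + k) ≡ j + (i + k)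
  swap₃ = ringℕ
  z--x : ∀ x → z -ᶻ - x ≡ z +ᶻ x
  z--x x = cong (z +ᶻ_) (ℤ.neg-involutive x)
  e₁ : ∀ x y → + 4 -ᶻ (- x +ᶻ - y) ≡ + 4 +ᶻ (y +ᶻ x)
  e₁ = ring
  e₂ : ∀ x y → - x -ᶻ - y ≡ y -ᶻ x
  e₂ = ring

distance-reflect : ∀ P → 0ℤ <ᶻ α P → distance (reflect P) ≡ suc (distance P)
distance-reflect P 0<α = trans (cong sum (table-reflect P 0<α)) (sum-bump (table P))

-- Adding `α P` to z - y and z - x gives z + x and z + y, and `below` is antitone. Together with
-- `α-positive` this makes the sign of `α P` readable from the first two entries of the table.
inversions-≤-rotate : ∀ P → 0ℤ <ᶻ α P → inversions P ≤ inversions (rotate P)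
inversions-≤-rotate P@(vertex x y z _) 0<α = begin
  below₃ (y +ᶻ x) (z +ᶻ x) (z +ᶻ y)
    ≡⟨ cong (_+ (below (z +ᶻ x) + below (z +ᶻ y))) (below-positive 0<α) ⟩
  below (z +ᶻ x) + below (z +ᶻ y)
    ≤⟨ +-mono-≤ (≤-below (z -ᶻ y) (e₁ x y z)) (≤-below (z -ᶻ x) (e₂ x y z)) ⟩
  below (z -ᶻ y) + below (z -ᶻ x)
    ≤⟨ +-monoʳ-≤ (below (z -ᶻ y)) (m≤m+n _ _) ⟩
  below₃ (z -ᶻ y) (z -ᶻ x) (+ 4 -ᶻ (y +ᶻ x))
    ≡⟨ inversions-rotate P ⟨
  inversions (rotate P) ∎
  where
  open ≤-Reasoning
  ≤-below : ∀ v {w} → v +ᶻ (y +ᶻ x) ≡ w → below w ≤ below v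
  ≤-below v refl = below-antitone
    (subst (_≤ᶻ v +ᶻ (y +ᶻ x)) (ℤ.+-identityʳ v) (ℤ.+-monoʳ-≤ v (ℤ.<⇒≤ 0<α)))
  e₁ : ∀ x y z → z -ᶻ y +ᶻ (y +ᶻ x) ≡ z +ᶻ x
  e₁ = ring
  e₂ : ∀ x y z → z -ᶻ x +ᶻ (y +ᶻ x) ≡ z +ᶻ y
  e₂ = ring

α-sign : ∀ P → 0ℤ <ᶻ α P ⊎ 0ℤ <ᶻ α (reflect P)
α-sign P with ℤ.<-cmp 0ℤ (α P)
... | tri< 0<α _ _ = inj₁ 0<α
... | tri≈ _ 0≡α _ = contradiction (sym 0≡α) (α≢0 P)
... | tri> _ _ α<0 = inj₂ (subst (0ℤ <ᶻ_) (sym (α-reflect P)) (ℤ.neg-mono-< α<0))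

α-rotate : ∀ P → let open V P in α (rotate P) ≡ z -ᶻ y
α-rotate (vertex x y z _) = e y z
  where
  e : ∀ y z → (+ 2 -ᶻ y) +ᶻ (z -ᶻ + 2) ≡ z -ᶻ y
  e = ring

α-rotate² : ∀ P → let open V P in α (rotate² P) ≡ y -ᶻ x
α-rotate² P@(vertex x y z _) = trans (α-rotate (rotate P)) (e x y)
  where
  e : ∀ x y → + 2 -ᶻ x -ᶻ (+ 2 -ᶻ y) ≡ y -ᶻ x
  e = ring

α-rotations-sum : ∀ P → α P +ᶻ (α (rotate P) +ᶻ (α (rotate² P) +ᶻ α (rotate³ P))) ≡ + 4
α-rotations-sum (vertex x y z _) = e x y z
  where
  e : ∀ x y z → (y +ᶻ x) +ᶻ (((+ 2 -ᶻ y) +ᶻ (z -ᶻ + 2)) +ᶻ (((+ 2 -ᶻ (+ 2 -ᶻ y)) +ᶻ ((+ 2 -ᶻ x) -ᶻ + 2)) +ᶻ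
      ((+ 2 -ᶻ (+ 2 -ᶻ (+ 2 -ᶻ y))) +ᶻ ((+ 2 -ᶻ (z -ᶻ + 2)) -ᶻ + 2)))) ≡ + 4
  e = ring

positives-summing-to-4 : ∀ {i j k l} → 0ℤ <ᶻ i → 0ℤ <ᶻ j → 0ℤ <ᶻ k → 0ℤ <ᶻ l →
  i +ᶻ (j +ᶻ (k +ᶻ l)) ≡ + 4 → i ≡ + 1 × j ≡ + 1 × k ≡ + 1
positives-summing-to-4 {+ suc i} {+ suc j} {+ suc k} {+ suc l} (+<+ _) (+<+ _) (+<+ _) (+<+ _) eq =
  cong (+_ ∘ suc) (m+n≡0⇒m≡0 i rest) ,
  cong (+_ ∘ suc) (m+n≡0⇒m≡0 j (m+n≡0⇒n≡0 i rest)) ,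
  cong (+_ ∘ suc) (m+n≡0⇒m≡0 k (m+n≡0⇒n≡0 j (m+n≡0⇒n≡0 i rest)))
  where
  e : ∀ i j k l → suc i + (suc j + (suc k + suc l)) ≡ 4 + (i + (j + (k + l)))
  e = ringℕ
  rest : i + (j + (k + l)) ≡ 0
  rest = +-cancelˡ-≡ 4 _ _ (trans (sym (e i j k l)) (ℤ.+-injective eq))

-- The four wall values are positive integers with sum 4, hence all equal to 1, and three of them
-- determine the point.
fundamental : ∀ P → 0ℤ <ᶻ α P → 0ℤ <ᶻ α (rotate P) → 0ℤ <ᶻ α (rotate² P) → 0ℤ <ᶻ α (rotate³ P) → P ≡ O
fundamental P@(vertex x y z _) 0<a 0<b 0<c 0<d
  with a≡1 , b≡1 , c≡1 ← positives-summing-to-4 0<a 0<b 0<c 0<d (α-rotations-sum P) = V-≡ x≡0 y≡1 z≡2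
  where
  e₁ : ∀ x y → y *ᶻ + 2 ≡ (y +ᶻ x) +ᶻ (y -ᶻ x)
  e₁ = ring
  e₂ : ∀ x y → x ≡ (y +ᶻ x) -ᶻ y
  e₂ = ring
  e₃ : ∀ y z → z ≡ (z -ᶻ y) +ᶻ y
  e₃ = ring
  y≡1 : y ≡ + 1
  y≡1 = ℤ.*-cancelʳ-≡ y (+ 1) (+ 2) (trans (e₁ x y) (cong₂ _+ᶻ_ a≡1 (trans (sym (α-rotate² P)) c≡1)))
  x≡0 : x ≡ + 0
  x≡0 = trans (e₂ x y) (cong₂ _-ᶻ_ a≡1 y≡1)
  z≡2 : z ≡ + 2
  z≡2 = trans (e₃ y z) (cong₂ _+ᶻ_ (trans (sym (α-rotate P)) b≡1) y≡1)

table-rotate³ : ∀ P → table (rotate³ P) ≡ rotl (rotl (rotl (table P)))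
table-rotate³ P = trans (table-rotate (rotate² P))
  (cong rotl (trans (table-rotate (rotate P)) (cong rotl (table-rotate P))))

-- Serves as an induction principle for `V`: geodesics, the zero in the table and the injectivity of
-- the table are all obtained along it.
data Generated : V → Set where
  origin  : Generated O
  rotated : ∀ {P} → Generated P → Generated (rotate P)
  raised  : ∀ {P} → Generated P → 0ℤ <ᶻ α P → Generated (reflect P)

-- Induction on the distance. If some wall value is negative, reflection in that wall lowers the
-- distance; if all four are positive, the point is `O`.
generated : ∀ P → Generated P
generated P = <-rec (λ n → ∀ P → distance P ≡ n → Generated P) induct (distance P) P refl
  where
  induct : ∀ n → (∀ {m} → m < n → ∀ P → distance P ≡ m → Generated P) →
           ∀ P → distance P ≡ n → Generated P
  induct n IH P refl = cases (α-sign P) (α-sign (rotate P)) (α-sign (rotate² P)) (α-sign (rotate³ P))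
    where
    descend : ∀ Q → distance Q ≡ distance P → 0ℤ <ᶻ α (reflect Q) → Generated Q
    descend Q eq 0<α = subst Generated (reflect-involutive Q) (raised (IH closer (reflect Q) refl) 0<α)
      where
      closer : distance (reflect Q) < distance P
      closer = ≤-reflexive (trans (sym (distance-reflect (reflect Q) 0<α))
        (trans (cong distance (reflect-involutive Q)) eq))

    dist¹ = distance-rotate P
    dist² = trans (distance-rotate (rotate P)) dist¹
    dist³ = trans (distance-rotate (rotate² P)) dist²

    cases : 0ℤ <ᶻ α P ⊎ 0ℤ <ᶻ α (reflect P) →
            0ℤ <ᶻ α (rotate P) ⊎ 0ℤ <ᶻ α (reflect (rotate P)) →
            0ℤ <ᶻ α (rotate² P) ⊎ 0ℤ <ᶻ α (reflect (rotate² P)) →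
            0ℤ <ᶻ α (rotate³ P) ⊎ 0ℤ <ᶻ α (reflect (rotate³ P)) → Generated P
    cases (inj₂ a) _ _ _ = descend P refl a
    -- The wall is turned into that of `reflect`, and the remaining turns out of four lead back to
    -- P.
    cases _ (inj₂ b) _ _ = subst Generated (rotate⁴ P) (rotated (rotated (rotated (descend (rotate P) dist¹ b))))
    cases _ _ (inj₂ c) _ = subst Generated (rotate⁴ P) (rotated (rotated (descend (rotate² P) dist² c)))
    cases _ _ _ (inj₂ d) = subst Generated (rotate⁴ P) (rotated (descend (rotate³ P) dist³ d))
    cases (inj₁ a) (inj₁ b) (inj₁ c) (inj₁ d) = subst Generated (sym (fundamental P a b c d)) origin

-- Walks of length `distance`, and injectivity of the table

module _ {A : Set} {R : Rel A 0ℓ} where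

  walk-prepend : ∀ {u v w n} → R u v → Walk R v w n → Walk R u w (suc n)
  walk-prepend uv start        = step start uv
  walk-prepend uv (step vw wx) = step (walk-prepend uv vw) wx

  walk-map : ∀ (h : A → A) → (∀ u v → R u v → R (h u) (h v)) →
             ∀ {u v n} → Walk R u v n → Walk R (h u) (h v) n
  walk-map h hom start        = start
  walk-map h hom (step uv vw) = step (walk-map h hom uv) (hom _ _ vw)

rotate-adjacent : ∀ P Q → Adjacent P Q → Adjacent (rotate P) (rotate Q)
rotate-adjacent (vertex x y z _) (vertex x′ y′ z′ _) adj = trans (e x y z x′ y′ z′) adj
  where
  -- The products `a *ᶻ (a *ᶻ + 1)` are what `a ^ᶻ 2` unfolds to.
  e : ∀ x y z x′ y′ z′ →
      let a = (z -ᶻ + 2) -ᶻ (z′ -ᶻ + 2) ; b = (+ 2 -ᶻ y) -ᶻ (+ 2 -ᶻ y′) ; c = (+ 2 -ᶻ x) -ᶻ (+ 2 -ᶻ x′) in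
      a *ᶻ (a *ᶻ + 1) +ᶻ b *ᶻ (b *ᶻ + 1) +ᶻ c *ᶻ (c *ᶻ + 1) ≡
      (x -ᶻ x′) *ᶻ ((x -ᶻ x′) *ᶻ + 1) +ᶻ (y -ᶻ y′) *ᶻ ((y -ᶻ y′) *ᶻ + 1) +ᶻ (z -ᶻ z′) *ᶻ ((z -ᶻ z′) *ᶻ + 1)
  e = ring

reflect-adjacent : ∀ P Q → Adjacent P Q → Adjacent (reflect P) (reflect Q)
reflect-adjacent (vertex x y z _) (vertex x′ y′ z′ _) adj = trans (e x y z x′ y′ z′) adj
  where
  e : ∀ x y z x′ y′ z′ →
      let a = - y -ᶻ - y′ ; b = - x -ᶻ - x′ ; c = z -ᶻ z′ in
      a *ᶻ (a *ᶻ + 1) +ᶻ b *ᶻ (b *ᶻ + 1) +ᶻ c *ᶻ (c *ᶻ + 1) ≡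
      (x -ᶻ x′) *ᶻ ((x -ᶻ x′) *ᶻ + 1) +ᶻ (y -ᶻ y′) *ᶻ ((y -ᶻ y′) *ᶻ + 1) +ᶻ (z -ᶻ z′) *ᶻ ((z -ᶻ z′) *ᶻ + 1)
  e = ring

-- A rotation fixes `O`. A reflection moves `O` to an adjacent vertex, so the reflected walk with
-- that edge put in front starts at `O` and is longer by one.
geodesic : ∀ {P} → Generated P → Walk Adjacent O P (distance P)
geodesic origin = start
geodesic (rotated {P} g) = subst (Walk Adjacent O (rotate P)) (sym (distance-rotate P))
  (walk-map rotate rotate-adjacent (geodesic g))
geodesic (raised {P} g 0<α) = subst (Walk Adjacent O (reflect P)) (sym (distance-reflect P 0<α))
  (walk-prepend {R = Adjacent} {v = reflect O} refl (walk-map reflect reflect-adjacent (geodesic g)))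

rotl-zero : ∀ {v} → Any (_≡ 0) v → Any (_≡ 0) (rotl v)
rotl-zero {_ ∷ _ ∷ _ ∷ _ ∷ []} (here p)                          = there (there (there (here p)))
rotl-zero {_ ∷ _ ∷ _ ∷ _ ∷ []} (there (here p))                  = here p
rotl-zero {_ ∷ _ ∷ _ ∷ _ ∷ []} (there (there (here p)))          = there (here p)
rotl-zero {_ ∷ _ ∷ _ ∷ _ ∷ []} (there (there (there (here p))))  = there (there (here p))

-- `bump` can destroy only a zero in second position; the first entry, being no larger, is then zero
-- too and survives.
table-has-zero : ∀ {P} → Generated P → Any (_≡ 0) (table P)
table-has-zero origin = here refl
table-has-zero (rotated {P} g) = subst (Any (_≡ 0)) (sym (table-rotate P)) (rotl-zero (table-has-zero g))
table-has-zero (raised {P} g 0<α) = subst (Any (_≡ 0)) (sym (table-reflect P 0<α))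
  (bump-zero (inversions-≤-rotate P 0<α) (table-has-zero g))
  where
  bump-zero : ∀ {i j k l} → i ≤ j → Any (_≡ 0) (i ∷ j ∷ k ∷ l ∷ []) → Any (_≡ 0) (bump (i ∷ j ∷ k ∷ l ∷ []))
  bump-zero i≤j (here i≡0)          = there (here i≡0)
  bump-zero i≤j (there (here refl)) = there (here (n≤0⇒n≡0 i≤j))
  bump-zero i≤j (there (there p))   = there (there p)

-- In `bump (table P)` the first entry exceeds the second, which `inversions-≤-rotate` rules out
-- when `α Q` is positive.
α-bump : ∀ {P Q} → 0ℤ <ᶻ α P → table Q ≡ bump (table P) → 0ℤ <ᶻ α (reflect Q)
α-bump {P} {Q} 0<α eq with α-sign Q
... | inj₂ pos = pos
... | inj₁ 0<αQ = contradiction (inversions-≤-rotate P 0<α) (<⇒≱ (begin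
  suc (inversions (rotate P)) ≡⟨ cong head eq ⟨
  inversions Q                ≤⟨ inversions-≤-rotate Q 0<αQ ⟩
  inversions (rotate Q)       ≡⟨ cong (head ∘ tail) eq ⟩
  inversions P                ∎))
  where open ≤-Reasoning

bump-injective : ∀ v w → bump v ≡ bump w → v ≡ w
bump-injective (_ ∷ _ ∷ _ ∷ _ ∷ []) (_ ∷ _ ∷ _ ∷ _ ∷ []) refl = refl

-- Each move that generates P is undone on Q as well. For a reflection this is possible because the
-- table alone shows, by `α-bump`, on which side of the wall Q lies.
table-injective : ∀ {P} → Generated P → ∀ Q → table P ≡ table Q → P ≡ Q
table-injective origin Q eq = fromOrigin (generated Q) (trans (cong sum (sym eq)) refl)
  where
  fromOrigin : ∀ {Q} → Generated Q → distance Q ≡ 0 → O ≡ Q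
  fromOrigin origin _ = refl
  fromOrigin (rotated {P} g) d≡0 = cong rotate (fromOrigin g (trans (sym (distance-rotate P)) d≡0))
  fromOrigin (raised {P} g 0<α) d≡0 with () ← trans (sym (distance-reflect P 0<α)) d≡0
table-injective (rotated {P} g) Q eq = trans (cong rotate (table-injective g (rotate³ Q) (begin
  table P                            ≡⟨ cong table (rotate⁴ P) ⟨
  table (rotate³ (rotate P))         ≡⟨ table-rotate³ (rotate P) ⟩
  rotl (rotl (rotl (table (rotate P)))) ≡⟨ cong (rotl ∘ rotl ∘ rotl) eq ⟩
  rotl (rotl (rotl (table Q)))       ≡⟨ table-rotate³ Q ⟨
  table (rotate³ Q)                  ∎))) (rotate⁴ Q)
  where open ≡-Reasoning
table-injective (raised {P} g 0<α) Q eq = trans (cong reflect (table-injective g (reflect Q)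
    (bump-injective (table P) (table (reflect Q)) (begin
      bump (table P)             ≡⟨ table-reflect P 0<α ⟨
      table (reflect P)          ≡⟨ eq ⟩
      table Q                    ≡⟨ cong table (reflect-involutive Q) ⟨
      table (reflect (reflect Q))
        ≡⟨ table-reflect (reflect Q) (α-bump {P} {Q} 0<α (trans (sym eq) (table-reflect P 0<α))) ⟩
      bump (table (reflect Q))   ∎))))
  (reflect-involutive Q)
  where open ≡-Reasoning

-- The graph distance

cost₃ : ℤ → ℤ → ℤ → ℕ
cost₃ a b c = cost (b +ᶻ a) + (cost (c +ᶻ a) + cost (c +ᶻ b))

Leads : ℤ → ℤ → ℤ → V → V → Set
Leads a b c (vertex x y z _) (vertex x′ y′ z′ _) = x′ ≡ x +ᶻ a × y′ ≡ y +ᶻ b × z′ ≡ z +ᶻ c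

leads-rotate : ∀ {a b c} P Q → Leads a b c P Q → Leads c (- b) (- a) (rotate P) (rotate Q)
leads-rotate {a} {b} {c} (vertex x y z _) (vertex x′ y′ z′ _) (refl , refl , refl) = e₁ z c , e₂ y b , e₂ x a
  where
  e₁ : ∀ z c → z +ᶻ c -ᶻ + 2 ≡ z -ᶻ + 2 +ᶻ c
  e₁ = ring
  e₂ : ∀ y b → + 2 -ᶻ (y +ᶻ b) ≡ + 2 -ᶻ y +ᶻ - b
  e₂ = ring

inversions-cost : ∀ {a b c} P Q → Leads a b c P Q → inversions Q ≤ cost₃ a b c + inversions P
inversions-cost {a} {b} {c} (vertex x y z p) (vertex x′ y′ z′ _) (refl , refl , refl) = begin
  below₃ (y +ᶻ b +ᶻ (x +ᶻ a)) (z +ᶻ c +ᶻ (x +ᶻ a)) (z +ᶻ c +ᶻ (y +ᶻ b))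
    ≡⟨ below₃-cong (interchange y b x a) (interchange z c x a) (interchange z c y b) ⟩
  below₃ (y +ᶻ x +ᶻ (b +ᶻ a)) (z +ᶻ x +ᶻ (c +ᶻ a)) (z +ᶻ y +ᶻ (c +ᶻ b))
    ≤⟨ +-mono-≤ (below-cost {y +ᶻ x} y+x (b +ᶻ a))
         (+-mono-≤ (below-cost {z +ᶻ x} z+x (c +ᶻ a)) (below-cost {z +ᶻ y} z+y (c +ᶻ b))) ⟩
  (cost (b +ᶻ a) + below (y +ᶻ x)) + ((cost (c +ᶻ a) + below (z +ᶻ x)) + (cost (c +ᶻ b) + below (z +ᶻ y)))
    ≡⟨ regroup (cost (b +ᶻ a)) (cost (c +ᶻ a)) (cost (c +ᶻ b)) _ _ _ ⟩
  cost₃ a b c + below₃ (y +ᶻ x) (z +ᶻ x) (z +ᶻ y) ∎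
  where
  open ≤-Reasoning
  interchange : ∀ i j k l → i +ᶻ j +ᶻ (k +ᶻ l) ≡ i +ᶻ k +ᶻ (j +ᶻ l)
  interchange = ring
  regroup : ∀ i j k l m n → (i + l) + ((j + m) + (k + n)) ≡ (i + (j + k)) + (l + (m + n))
  regroup = ringℕ
  y+x : ¬ ≡0mod4 (y +ᶻ x)
  y+x d = ⊥-elim-irr (proj₁ p (subst ≡0mod4 (ℤ.+-comm y x) d))
  z+x : ¬ ≡0mod4 (z +ᶻ x)
  z+x d = ⊥-elim-irr (proj₁ (proj₂ (proj₂ (proj₂ (proj₂ p)))) d)
  z+y : ¬ ≡0mod4 (z +ᶻ y)
  z+y d = ⊥-elim-irr (proj₁ (proj₂ (proj₂ p)) (subst ≡0mod4 (ℤ.+-comm z y) d))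

cost₁₂ : ℤ → ℤ → ℤ → ℕ
cost₁₂ a b c = cost₃ a b c + (cost₃ c (- b) (- a) + (cost₃ (- a) (- - b) (- c) + cost₃ (- c) (- - - b) (- - a)))

distance-cost : ∀ {a b c} P Q → Leads a b c P Q → distance Q ≤ cost₁₂ a b c + distance P
distance-cost {a} {b} {c} P Q l = begin
  inversions Q + (inversions (rotate Q) + (inversions (rotate² Q) + (inversions (rotate³ Q) + 0)))
    ≤⟨ +-mono-≤ (inversions-cost P Q l) (+-mono-≤ (inversions-cost (rotate P) (rotate Q) l¹)
        (+-mono-≤ (inversions-cost (rotate² P) (rotate² Q) l²)
          (+-mono-≤ (inversions-cost (rotate³ P) (rotate³ Q) l³) ≤-refl))) ⟩
  _ ≡⟨ regroup (cost₃ a b c) (cost₃ c (- b) (- a)) (cost₃ (- a) (- - b) (- c)) (cost₃ (- c) (- - - b) (- - a))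
         (inversions P) (inversions (rotate P)) (inversions (rotate² P)) (inversions (rotate³ P)) ⟩
  cost₁₂ a b c + distance P ∎
  where
  open ≤-Reasoning
  l¹ = leads-rotate P Q l
  l² = leads-rotate (rotate P) (rotate Q) l¹
  l³ = leads-rotate (rotate² P) (rotate² Q) l²
  regroup : ∀ i j k l p q r s → (i + p) + ((j + q) + ((k + r) + ((l + s) + 0))) ≡
            (i + (j + (k + l))) + (p + (q + (r + (s + 0))))
  regroup = ringℕ

data Small : ℤ → Set where
  minus : Small -[1+ 0 ]
  nil   : Small (+ 0)
  plus  : Small (+ 1)

square-∣∣ : ∀ i → i ^ᶻ 2 ≡ + (∣ i ∣ * ∣ i ∣)
square-∣∣ (+ 0)       = refl
square-∣∣ (+ (suc n)) = cong (λ m → + (suc n * m)) (*-identityʳ (suc n))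
square-∣∣ -[1+ n ]    = cong (λ m → + (suc n * m)) (*-identityʳ (suc n))

square>2 : ∀ n m → (2 + n) * (2 + n) + m ≢ 2
square>2 n m eq = contradiction (trans (sym (e n m)) eq) (λ ())
  where
  e : ∀ n m → (2 + n) * (2 + n) + m ≡ 4 + (4 * n + n * n + m)
  e = ringℕ

small : ∀ i {m} → ∣ i ∣ * ∣ i ∣ + m ≡ 2 → Small i
small (+ 0)             _ = nil
small (+ 1)             _ = plus
small -[1+ 0 ]          _ = minus
small (+ (suc (suc n))) {m} eq = contradiction eq (square>2 n m)
small -[1+ suc n ]      {m} eq = contradiction eq (square>2 n m)

-- Along an edge one form changes by 2 and the others by at most 1. Each form occurs with both signs
-- among the twelve terms, and only the term in which the first one falls by 2 contributes, namely
-- 1.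
edge-cost : ∀ {a b c} → Small a → Small b → Small c → a ^ᶻ 2 +ᶻ b ^ᶻ 2 +ᶻ c ^ᶻ 2 ≡ + 2 →
            cost₁₂ (- a) (- b) (- c) ≡ 1
edge-cost nil   plus  plus  refl = refl
edge-cost nil   plus  minus refl = refl
edge-cost nil   minus plus  refl = refl
edge-cost nil   minus minus refl = refl
edge-cost plus  nil   plus  refl = refl
edge-cost plus  nil   minus refl = refl
edge-cost minus nil   plus  refl = refl
edge-cost minus nil   minus refl = refl
edge-cost plus  plus  nil   refl = refl
edge-cost plus  minus nil   refl = refl
edge-cost minus plus  nil   refl = refl
edge-cost minus minus nil   refl = refl
edge-cost nil   nil   nil   ()
edge-cost nil   nil   plus  ()
edge-cost nil   nil   minus ()

distance-edge : ∀ P Q → Adjacent P Q → distance Q ≤ suc (distance P)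
distance-edge P@(vertex x y z _) Q@(vertex x′ y′ z′ _) adj =
  -- `distanceSquared` takes differences P - Q, so the displacement from P to Q is their negative.
  subst (λ c → distance Q ≤ c + distance P)
    (edge-cost (small a (trans (sym (+-assoc (∣ a ∣ * ∣ a ∣) _ _)) squares))
               (small b (trans (e₁ (∣ a ∣ * ∣ a ∣) (∣ b ∣ * ∣ b ∣) _) squares))
               (small c (trans (+-comm (∣ c ∣ * ∣ c ∣) _) squares)) adj)
    (distance-cost P Q (e₂ x x′ , e₂ y y′ , e₂ z z′))
  where
  a = x -ᶻ x′
  b = y -ᶻ y′
  c = z -ᶻ z′
  squares : ∣ a ∣ * ∣ a ∣ + ∣ b ∣ * ∣ b ∣ + ∣ c ∣ * ∣ c ∣ ≡ 2
  squares = ℤ.+-injective (trans (sym (cong₂ _+ᶻ_ (cong₂ _+ᶻ_ (square-∣∣ a) (square-∣∣ b)) (square-∣∣ c))) adj)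
  e₁ : ∀ i j k → j + (i + k) ≡ i + j + k
  e₁ = ringℕ
  e₂ : ∀ x x′ → x′ ≡ x +ᶻ - (x -ᶻ x′)
  e₂ = ring

distance-walk : ∀ {P n} → Walk Adjacent O P n → distance P ≤ n
distance-walk start = z≤n
distance-walk (step {v} {w} walk vw) = ≤-trans (distance-edge v w vw) (s≤s (distance-walk walk))

sphere : ∀ n → (λ P → distance P ≡ n) ≐ Sphere n
sphere n =
  (λ { {P} refl → geodesic (generated P) , λ m → distance-walk }) ,
  (λ { {P} (walk , shortest) → ≤-antisym (distance-walk walk) (shortest (distance P) (geodesic (generated P))) })

-- The coordination sequence

α-positive : ∀ P → inversions P ≤ inversions (rotate P) → 0ℤ <ᶻ α P
α-positive P le with α-sign P
... | inj₁ 0<α = 0<α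
... | inj₂ 0<α = contradiction le (<⇒≱ (begin-strict
  inversions (rotate P) ≡⟨ cong (head ∘ tail) eq ⟩
  inversions (reflect P) <⟨ s≤s (inversions-≤-rotate (reflect P) 0<α) ⟩
  suc (inversions (rotate (reflect P))) ≡⟨ cong head eq ⟨
  inversions P ∎))
  where
  open ≤-Reasoning
  eq : table P ≡ bump (table (reflect P))
  eq = trans (cong table (sym (reflect-involutive P))) (table-reflect (reflect P) 0<α)

Realised : Vec ℕ 4 → Set
Realised v = ∃[ P ] table P ≡ v

unrotate : ∀ v → Realised (rotl v) → Realised v
unrotate v@(_ ∷ _ ∷ _ ∷ _ ∷ []) (P , eq) = rotate³ P , trans (table-rotate³ P) (cong (rotl ∘ rotl ∘ rotl) eq)

-- Induction on the sum. An entry larger than its cyclic successor is rotated to the front, where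
-- undoing `bump` lowers the sum. Without such an entry all four are equal, hence zero, and `O` has
-- this table.
realised : ∀ v → Any (_≡ 0) v → Realised v
realised v = <-rec (λ n → ∀ v → sum v ≡ n → Any (_≡ 0) v → Realised v) induct (sum v) v refl
  where
  module _ n (IH : ∀ {m} → m < n → ∀ v → sum v ≡ m → Any (_≡ 0) v → Realised v) where

    unbump : ∀ {i j k l} → Any (_≡ 0) (suc i ∷ j ∷ k ∷ l ∷ []) → Any (_≡ 0) (j ∷ i ∷ k ∷ l ∷ [])
    unbump (there (here p))  = here p
    unbump (there (there p)) = there (there p)

    descend : ∀ v → sum v ≡ n → Any (_≡ 0) v → head (tail v) < head v → Realised v
    descend (suc i ∷ j ∷ k ∷ l ∷ []) refl v0 (s≤s j≤i) =
      let P , tP = IH (≤-reflexive (sym (sum-bump (j ∷ i ∷ k ∷ l ∷ [])))) (j ∷ i ∷ k ∷ l ∷ []) refl (unbump v0)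
          0<α = α-positive P (subst₂ _≤_ (sym (cong head tP)) (sym (cong (head ∘ tail) tP)) j≤i)
      in reflect P , trans (table-reflect P 0<α) (cong bump tP)

    sorted : ∀ {i j k l} → i ≤ j → j ≤ k → k ≤ l → l ≤ i → Any (_≡ 0) (i ∷ j ∷ k ∷ l ∷ []) →
             Realised (i ∷ j ∷ k ∷ l ∷ [])
    sorted i≤j j≤k k≤l l≤i v0
      with refl ← ≤-antisym i≤j (≤-trans j≤k (≤-trans k≤l l≤i))
         | refl ← ≤-antisym j≤k (≤-trans k≤l (≤-trans l≤i i≤j))
         | refl ← ≤-antisym k≤l (≤-trans l≤i (≤-trans i≤j j≤k))
         with v0
    ... | here refl                         = O , refl
    ... | there (here refl)                 = O , refl
    ... | there (there (here refl))         = O , refl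
    ... | there (there (there (here refl))) = O , refl

    induct : ∀ v → sum v ≡ n → Any (_≡ 0) v → Realised v
    induct v@(i ∷ j ∷ k ∷ l ∷ []) sum≡n v0
      with ≤-<-connex i j | ≤-<-connex j k | ≤-<-connex k l | ≤-<-connex l i
    ... | inj₂ j<i | _ | _ | _ = descend v sum≡n v0 j<i
    ... | _ | inj₂ k<j | _ | _ = unrotate v (descend (rotl v) (trans (sum-rotl v) sum≡n) (rotl-zero v0) k<j)
    ... | _ | _ | inj₂ l<k | _ = unrotate v (unrotate (rotl v)
      (descend (rotl (rotl v)) (trans (sum-rotl (rotl v)) (trans (sum-rotl v) sum≡n)) (rotl-zero (rotl-zero v0)) l<k))
    ... | _ | _ | _ | inj₂ i<l = unrotate v (unrotate (rotl v) (unrotate (rotl (rotl v))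
      (descend (rotl (rotl (rotl v)))
        (trans (sum-rotl (rotl (rotl v))) (trans (sum-rotl (rotl v)) (trans (sum-rotl v) sum≡n)))
        (rotl-zero (rotl-zero (rotl-zero v0))) i<l)))
    ... | inj₁ i≤j | inj₁ j≤k | inj₁ k≤l | inj₁ l≤i = sorted i≤j j≤k k≤l l≤i v0

-- For `k` at most the length, parametrises the vectors whose first zero is at position `k`:
-- positive entries before it, arbitrary ones after it.
insertZero : ∀ (k : ℕ) {n} → Vec ℕ n → Vec ℕ (suc n)
insertZero zero    v       = 0 ∷ v
-- Reached only when `k` exceeds the length; this default keeps `insertZero-zero` true for every
-- `k`.
insertZero (suc k) []      = 0 ∷ []
insertZero (suc k) (i ∷ v) = suc i ∷ insertZero k v

insertZero-zero : ∀ k {n} (v : Vec ℕ n) → Any (_≡ 0) (insertZero k v)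
insertZero-zero zero    v       = here refl
insertZero-zero (suc k) []      = here refl
insertZero-zero (suc k) (i ∷ v) = there (insertZero-zero k v)

insertZero-injective : ∀ k {n} {v w : Vec ℕ n} → insertZero k v ≡ insertZero k w → v ≡ w
insertZero-injective zero    refl = refl
insertZero-injective (suc k) {v = []}    {[]}    _  = refl
insertZero-injective (suc k) {v = i ∷ v} {j ∷ w} eq =
  cong₂ _∷_ (suc-injective (cong head eq)) (insertZero-injective k (cong tail eq))

sum-insertZero : ∀ {k n} → k ≤ n → ∀ (v : Vec ℕ n) → sum (insertZero k v) ≡ k + sum v
sum-insertZero {zero}  _         v       = refl
sum-insertZero {suc k} (s≤s k≤n) (i ∷ v) =
  cong suc (trans (cong (_+_ i) (sum-insertZero k≤n v)) (e i k (sum v)))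
  where
  e : ∀ i k s → i + (k + s) ≡ k + (i + s)
  e = ringℕ

LeadingPositive : ℕ → ∀ {n} → Vec ℕ n → Set
LeadingPositive zero    _           = ⊤
LeadingPositive (suc k) []          = ⊥
LeadingPositive (suc k) (zero  ∷ _) = ⊥
LeadingPositive (suc k) (suc _ ∷ v) = LeadingPositive k v

insertZero-leading : ∀ {k n} → k ≤ n → ∀ (v : Vec ℕ n) → LeadingPositive k (insertZero k v)
insertZero-leading {zero}  _         v       = tt
insertZero-leading {suc k} (s≤s k≤n) (i ∷ v) = insertZero-leading k≤n v

insertZero-not-leading : ∀ k {n} (v : Vec ℕ n) → ¬ LeadingPositive (suc k) (insertZero k v)
insertZero-not-leading zero    v       ()
insertZero-not-leading (suc k) []      ()
insertZero-not-leading (suc k) (i ∷ v) p = insertZero-not-leading k v p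

leading-pred : ∀ k {n} (v : Vec ℕ n) → LeadingPositive (suc k) v → LeadingPositive k v
leading-pred zero    v           _ = tt
leading-pred (suc k) (suc _ ∷ v) p = leading-pred k v p

first-zero : ∀ k {n} (v : Vec ℕ (suc n)) → Any (_≡ 0) v → LeadingPositive k v →
             LeadingPositive (suc k) v ⊎ ∃[ w ] insertZero k w ≡ v
first-zero zero    (zero  ∷ v) _          _ = inj₂ (v , refl)
first-zero zero    (suc i ∷ v) _          _ = inj₁ tt
first-zero (suc k) {suc n} (suc i ∷ v) (there v0) p with first-zero k v v0 p
... | inj₁ p′         = inj₁ p′
... | inj₂ (w , refl) = inj₂ (i ∷ w , refl)

not-all-leading : ∀ {n} (v : Vec ℕ n) → Any (_≡ 0) v → ¬ LeadingPositive n v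
not-all-leading (suc i ∷ v) (there v0) p = not-all-leading v v0 p

-- Peels off the vertices whose table has its first zero at position `k`. By `realised` and
-- `table-injective` they correspond to the triples of naturals, with `k` added to the sum.
table-split : ∀ {k} → k ≤ 3 → Splits distance
  (λ P → LeadingPositive k (table P)) (λ P → LeadingPositive (suc k) (table P))
  (sum {3}) (λ v → proj₁ (realised (insertZero k v) (insertZero-zero k v))) U k
table-split {k} k≤3 = record
  { injective = λ {v} {w} eq → insertZero-injective k
      (trans (sym (table-φ v)) (trans (cong table eq) (table-φ w)))
  ; weight    = λ {v} _ → trans (cong sum (table-φ v)) (sum-insertZero k≤3 v)
  ; sound     = λ { {P} (inj₁ lp) → leading-pred k (table P) lp
                  ; (inj₂ (v , _ , refl)) →
                      subst (LeadingPositive k) (sym (table-φ v)) (insertZero-leading k≤3 v) }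
  ; complete  = λ {P} lp → map₂
      (λ { (v , eq) → v , _ , table-injective (generated (φ v)) P (trans (table-φ v) eq) })
      (first-zero k (table P) (table-has-zero (generated P)) lp)
  ; disjoint  = λ {v} _ lp → insertZero-not-leading k v (subst (LeadingPositive (suc k)) (table-φ v) lp)
  }
  where
  φ : Vec ℕ 3 → V
  φ v = proj₁ (realised (insertZero k v) (insertZero-zero k v))
  table-φ : ∀ v → table (φ v) ≡ insertZero k v
  table-φ v = proj₂ (realised (insertZero k v) (insertZero-zero k v))

triangular : ℕ → ℕ
triangular = compositions 3

coordination : ℕ → ℕ
coordination n = 0 + shift 3 triangular n + shift 2 triangular n + shift 1 triangular n + triangular n

counted-V : Counted distance U coordination
counted-V = counted-resp ((λ _ → _) , (λ _ → tt)) (λ _ → refl)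
  (counted-split (table-split {0} z≤n)
    (counted-split (table-split {1} (s≤s z≤n))
      (counted-split (table-split {2} (s≤s (s≤s z≤n)))
        (counted-split (table-split {3} (s≤s (s≤s (s≤s z≤n))))
          -- What is left after four splits is empty: no table has four positive entries.
          (counted-resp ((λ ()) , λ {P} → not-all-leading (table P) (table-has-zero (generated P))) (λ _ → refl)
            (counted-∅ {w = distance}))
          (counted-Vec 3)) (counted-Vec 3)) (counted-Vec 3)) (counted-Vec 3))

compositions-1 : ∀ n → compositions 1 n ≡ 1
compositions-1 zero    = refl
compositions-1 (suc n) = compositions-1 n

compositions-2 : ∀ n → compositions 2 n ≡ suc n
compositions-2 zero    = refl
compositions-2 (suc n) = cong₂ _+_ (compositions-1 (suc n)) (compositions-2 n)

triangular-suc : ∀ n → triangular (suc n) ≡ 2 + n + triangular n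
triangular-suc n = cong (_+ triangular n) (compositions-2 (suc n))

triangular-twice : ∀ n → 2 * triangular n ≡ suc n * (2 + n)
triangular-twice zero    = refl
triangular-twice (suc n) = begin
  2 * triangular (suc n)         ≡⟨ cong (2 *_) (triangular-suc n) ⟩
  2 * (2 + n + triangular n)     ≡⟨ *-distribˡ-+ 2 (2 + n) (triangular n) ⟩
  2 * (2 + n) + 2 * triangular n ≡⟨ cong (_+_ (2 * (2 + n))) (triangular-twice n) ⟩
  2 * (2 + n) + suc n * (2 + n)  ≡⟨ e n ⟩
  (2 + n) * (3 + n)              ∎
  where
  open ≡-Reasoning
  e : ∀ n → 2 * (2 + n) + suc n * (2 + n) ≡ (2 + n) * (3 + n)
  e = ringℕ

coordination-formula : ∀ n → n > 0 → coordination n ≡ 2 * (n ^ 2 + 1)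
coordination-formula 1 _ = refl
coordination-formula 2 _ = refl
-- From 3 on none of the shifts is cut off, and all four terms are present.
coordination-formula (suc (suc (suc n))) _ = begin
  triangular n + triangular (1 + n) + triangular (2 + n) + triangular (3 + n)
    ≡⟨ cong₂ _+_ (cong₂ _+_ (cong (_+_ (triangular n)) t₁) t₂) t₃ ⟩
  triangular n + (2 + n + triangular n) + (3 + n + (2 + n + triangular n)) + (4 + n + (3 + n + (2 + n + triangular n)))
    ≡⟨ e₁ n (triangular n) ⟩
  2 * (2 * triangular n) + (16 + 6 * n)
    ≡⟨ cong (λ t → 2 * t + (16 + 6 * n)) (triangular-twice n) ⟩
  2 * (suc n * (2 + n)) + (16 + 6 * n)
    ≡⟨ e₂ n ⟩
  2 * ((3 + n) * ((3 + n) * 1) + 1) ∎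
  where
  open ≡-Reasoning
  t₁ = triangular-suc n
  t₂ = trans (triangular-suc (1 + n)) (cong (_+_ (3 + n)) t₁)
  t₃ = trans (triangular-suc (2 + n)) (cong (_+_ (4 + n)) t₂)
  e₁ : ∀ n t → t + (2 + n + t) + (3 + n + (2 + n + t)) + (4 + n + (3 + n + (2 + n + t))) ≡
       2 * (2 * t) + (16 + 6 * n)
  e₁ = ringℕ
  e₂ : ∀ n → 2 * (suc n * (2 + n)) + (16 + 6 * n) ≡ 2 * ((3 + n) * ((3 + n) * 1) + 1)
  e₂ = ringℕ

sphere-cardinality : ∀ n → HasCardinality (Sphere n) (coordination n)
sphere-cardinality n =
  card-resp ((λ { (_ , eq) → proj₁ (sphere n) eq }) , (λ s → _ , proj₂ (sphere n) s)) (counted-V n)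

-- Planar vertices

¬0mod4-+-comm : ∀ i j → ¬ ≡0mod4 (i +ᶻ j) → ¬ ≡0mod4 (j +ᶻ i)
¬0mod4-+-comm i j = subst (λ k → ¬ ≡0mod4 k) (ℤ.+-comm i j)

¬0mod4---comm : ∀ i j → ¬ ≡0mod4 (i -ᶻ j) → ¬ ≡0mod4 (j -ᶻ i)
¬0mod4---comm i j = ¬0mod4-reflect (j -ᶻ i) (+ 0) (e i j)
  where
  e : ∀ i j → i -ᶻ j ≡ - (j -ᶻ i) +ᶻ + 0 *ᶻ + 4
  e = ring

InV-swap₂ : ∀ x y z → InV x y z → InV x z y
InV-swap₂ x y z (x+y , x-y , y+z , y-z , z+x , z-x) =
  ¬0mod4-+-comm z x z+x , ¬0mod4---comm z x z-x ,
  ¬0mod4-+-comm y z y+z , ¬0mod4---comm y z y-z ,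
  ¬0mod4-+-comm x y x+y , ¬0mod4---comm x y x-y

InV-swap₃ : ∀ x y z → InV x y z → InV y x z
InV-swap₃ x y z (x+y , x-y , y+z , y-z , z+x , z-x) =
  ¬0mod4-+-comm x y x+y , ¬0mod4---comm x y x-y ,
  ¬0mod4-+-comm z x z+x , ¬0mod4---comm z x z-x ,
  ¬0mod4-+-comm y z y+z , ¬0mod4---comm y z y-z

reflect₂ reflect₃ : V → V
reflect₂ (vertex x y z p) = vertex x z y (InV-swap₂ x y z p)
reflect₃ (vertex x y z p) = vertex y x z (InV-swap₃ x y z p)

-- Since `rotate` preserves `distance`, the effect of `reflect₂` on it is inherited from `reflect`.
reflect₂-conjugate : ∀ P → rotate³ (reflect (rotate P)) ≡ reflect₂ P
reflect₂-conjugate (vertex x y z _) = V-≡ (e₁ x) (e₂ z) (e₃ y)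
  where
  e₁ : ∀ x → + 2 -ᶻ (+ 2 -ᶻ x -ᶻ + 2) -ᶻ + 2 ≡ x
  e₁ = ring
  e₂ : ∀ z → + 2 -ᶻ (+ 2 -ᶻ (+ 2 -ᶻ - (z -ᶻ + 2))) ≡ z
  e₂ = ring
  e₃ : ∀ y → + 2 -ᶻ (+ 2 -ᶻ - (+ 2 -ᶻ y) -ᶻ + 2) ≡ y
  e₃ = ring

reflect₃-conjugate : ∀ P → rotate² (reflect (rotate² P)) ≡ reflect₃ P
reflect₃-conjugate (vertex x y z _) = V-≡ (e₁ y) (e₂ x) (e₃ z)
  where
  e₁ : ∀ y → + 2 -ᶻ - (+ 2 -ᶻ (+ 2 -ᶻ y)) -ᶻ + 2 ≡ y
  e₁ = ring
  e₂ : ∀ x → + 2 -ᶻ (+ 2 -ᶻ - (+ 2 -ᶻ x -ᶻ + 2)) ≡ x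
  e₂ = ring
  e₃ : ∀ z → + 2 -ᶻ (+ 2 -ᶻ (z -ᶻ + 2) -ᶻ + 2) ≡ z
  e₃ = ring

-- Unfolding the fundamental chamber

Forms : Set
Forms = ℤ × ℤ × ℤ

-- These vanish on the three walls of the alcove of `O` that pass through the origin. The
-- reflections in them act linearly on the triple, so regions can be compared by linear inequalities
-- alone.
forms : V → Forms
forms (vertex x y z _) = y +ᶻ x , z -ᶻ y , y -ᶻ x

Planar : Pred V 0ℓ
Planar P = V.x P *ᶻ V.y P *ᶻ V.z P ≡ 0ℤ

record Wall : Set where
  field
    mirror             : V → V
    act                : Forms → Forms
    form               : Forms → ℤ
    mirror-involutive  : ∀ P → mirror (mirror P) ≡ P
    mirror-planar      : ∀ P → Planar P → Planar (mirror P)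
    mirror-forms       : ∀ P → forms (mirror P) ≡ act (forms P)
    form-act           : ∀ f → form (act f) ≡ - form f
    form≢0             : ∀ P → form (forms P) ≢ 0ℤ
    mirror-distance    : ∀ P → 0ℤ <ᶻ form (forms P) → distance (mirror P) ≡ suc (distance P)

Region : Pred Forms 0ℓ → Pred V 0ℓ
Region C P = Planar P × C (forms P)

module _ (W : Wall) where
  open Wall W

  -- The wall cuts the region of `C` in two. The four implications say that `A` is the part on the
  -- positive side and `B` the mirror image of the rest, where the distance is smaller by one.
  counted-wall : ∀ {A B C : Pred Forms 0ℓ} {f g} →
    (∀ {i} → A i → 0ℤ <ᶻ form i × C i) → (∀ {i} → 0ℤ <ᶻ form i → C i → A i) →
    (∀ {i} → B i → 0ℤ <ᶻ form i × C (act i)) → (∀ {i} → 0ℤ <ᶻ form i → C (act i) → B i) →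
    Counted distance (Region A) f → Counted distance (Region B) g →
    Counted distance (Region C) (λ n → f n + shift 1 g n)
  counted-wall {A} {B} {C} A⇒C C⇒A B⇒C C⇒B = counted-split record
    { injective = λ {P} {Q} eq → trans (sym (mirror-involutive P)) (trans (cong mirror eq) (mirror-involutive Q))
    ; weight    = λ {P} (_ , b) → mirror-distance P (proj₁ (B⇒C b))
    ; sound     = λ { (inj₁ (pl , a)) → pl , proj₂ (A⇒C a)
                    ; (inj₂ (P , (pl , b) , refl)) →
                        mirror-planar P pl , subst C (sym (mirror-forms P)) (proj₂ (B⇒C b)) }
    ; complete  = λ {P} → complete P
    ; disjoint  = λ {P} (_ , b) (_ , a) → ℤ.<-asym (proj₁ (B⇒C b)) (negative P (proj₁ (A⇒C a)))
    }
    where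
    form-mirror : ∀ P → form (forms (mirror P)) ≡ - form (forms P)
    form-mirror P = trans (cong form (mirror-forms P)) (form-act (forms P))

    negative : ∀ P → 0ℤ <ᶻ form (forms (mirror P)) → form (forms P) <ᶻ 0ℤ
    negative P 0<f = ℤ.neg-cancel-< (subst (0ℤ <ᶻ_) (form-mirror P) 0<f)

    complete : ∀ P → Region C P → Region A P ⊎ Image mirror (Region B) P
    complete P (pl , c) with ℤ.<-cmp 0ℤ (form (forms P))
    ... | tri< 0<f _ _ = inj₁ (pl , C⇒A 0<f c)
    ... | tri≈ _ 0≡f _ = contradiction (sym 0≡f) (form≢0 P)
    ... | tri> _ _ f<0 = inj₂
      ( mirror P
      , ( mirror-planar P pl
        , C⇒B (subst (0ℤ <ᶻ_) (sym (form-mirror P)) (ℤ.neg-mono-< f<0))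
              (subst C (trans (cong forms (sym (mirror-involutive P))) (mirror-forms (mirror P))) c) )
      , mirror-involutive P )

wall₁ wall₂ wall₃ : Wall
wall₁ = record
  { mirror            = reflect
  ; act               = λ (a , b , c) → - a , b +ᶻ a , c
  ; form              = proj₁
  ; mirror-involutive = reflect-involutive
  ; mirror-planar     = λ (vertex x y z _) pl → trans (e x y z) pl
  ; mirror-forms      = λ (vertex x y z _) → cong₂ _,_ (e₁ x y) (cong₂ _,_ (e₂ x y z) (e₃ x y))
  ; form-act          = λ _ → refl
  ; form≢0            = α≢0
  ; mirror-distance   = distance-reflect
  }
  where
  e : ∀ x y z → - y *ᶻ - x *ᶻ z ≡ x *ᶻ y *ᶻ z
  e = ring
  e₁ : ∀ x y → - x +ᶻ - y ≡ - (y +ᶻ x)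
  e₁ = ring
  e₂ : ∀ x y z → z -ᶻ - x ≡ (z -ᶻ y) +ᶻ (y +ᶻ x)
  e₂ = ring
  e₃ : ∀ x y → - x -ᶻ - y ≡ y -ᶻ x
  e₃ = ring
wall₂ = record
  { mirror            = reflect₂
  ; act               = λ (a , b , c) → a +ᶻ b , - b , c +ᶻ b
  ; form              = λ (a , b , c) → b
  ; mirror-involutive = λ _ → refl
  ; mirror-planar     = λ (vertex x y z _) pl → trans (e x y z) pl
  ; mirror-forms      = λ (vertex x y z _) → cong₂ _,_ (e₁ x y z) (cong₂ _,_ (e₂ y z) (e₃ x y z))
  ; form-act          = λ _ → refl
  ; form≢0            = λ P eq → α≢0 (rotate P) (trans (α-rotate P) eq)
  ; mirror-distance   = λ P 0<b → trans (cong distance (sym (reflect₂-conjugate P)))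
      (trans (distance-rotate³ (reflect (rotate P)))
      (trans (distance-reflect (rotate P) (subst (0ℤ <ᶻ_) (sym (α-rotate P)) 0<b)) (cong suc (distance-rotate P))))
  }
  where
  distance-rotate³ : ∀ P → distance (rotate³ P) ≡ distance P
  distance-rotate³ P = trans (distance-rotate (rotate² P)) (trans (distance-rotate (rotate P)) (distance-rotate P))
  e : ∀ x y z → x *ᶻ z *ᶻ y ≡ x *ᶻ y *ᶻ z
  e = ring
  e₁ : ∀ x y z → z +ᶻ x ≡ (y +ᶻ x) +ᶻ (z -ᶻ y)
  e₁ = ring
  e₂ : ∀ y z → y -ᶻ z ≡ - (z -ᶻ y)
  e₂ = ring
  e₃ : ∀ x y z → z -ᶻ x ≡ (y -ᶻ x) +ᶻ (z -ᶻ y)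
  e₃ = ring
wall₃ = record
  { mirror            = reflect₃
  ; act               = λ (a , b , c) → a , b +ᶻ c , - c
  ; form              = λ (a , b , c) → c
  ; mirror-involutive = λ _ → refl
  ; mirror-planar     = λ (vertex x y z _) pl → trans (cong (_*ᶻ z) (ℤ.*-comm y x)) pl
  ; mirror-forms      = λ (vertex x y z _) → cong₂ _,_ (ℤ.+-comm x y) (cong₂ _,_ (e₁ x y z) (e₂ x y))
  ; form-act          = λ _ → refl
  ; form≢0            = λ P eq → α≢0 (rotate² P) (trans (α-rotate² P) eq)
  ; mirror-distance   = λ P 0<c → trans (cong distance (sym (reflect₃-conjugate P)))
      (trans (distance-rotate² (reflect (rotate² P)))
      (trans (distance-reflect (rotate² P) (subst (0ℤ <ᶻ_) (sym (α-rotate² P)) 0<c)) (cong suc (distance-rotate² P))))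
  }
  where
  distance-rotate² : ∀ P → distance (rotate² P) ≡ distance P
  distance-rotate² P = trans (distance-rotate (rotate P)) (distance-rotate P)
  e₁ : ∀ x y z → z -ᶻ x ≡ (z -ᶻ y) +ᶻ (y -ᶻ x)
  e₁ = ring
  e₂ : ∀ x y → x -ᶻ y ≡ - (y -ᶻ x)
  e₂ = ring

-- Each Fold region is the mirror image of what a wall cuts off from a larger region:
-- Fold₂ comes from Chamber₂, Fold₂₁ from Fold₂ and Fold₁ from Chamber₁.
Chamber₃ Chamber₂ Chamber₁ Chamber₀ Fold₂₁ Fold₂ Fold₁ : Pred Forms 0ℓ
Chamber₃ (a , b , c) = 0ℤ <ᶻ a × 0ℤ <ᶻ b × 0ℤ <ᶻ c
Chamber₂ (a , b , c) = 0ℤ <ᶻ a × 0ℤ <ᶻ b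
Chamber₁ (a , b , c) = 0ℤ <ᶻ a
Chamber₀ _           = ⊤
Fold₂    (a , b , c) = 0ℤ <ᶻ a × 0ℤ <ᶻ c × 0ℤ <ᶻ c +ᶻ b
Fold₂₁   (a , b , c) = 0ℤ <ᶻ a +ᶻ b × 0ℤ <ᶻ b × 0ℤ <ᶻ c
Fold₁    (a , b , c) = 0ℤ <ᶻ a +ᶻ b × 0ℤ <ᶻ b

module _ {p : ℕ → ℕ} (counted-Chamber₃ : Counted distance (Region Chamber₃) p) where

  -- In generating functions, `chamber₂` is p times 1 + q + q² + q³, `chamber₁` has the further
  -- factor 1 + q + q², and `chamber₀` the further factor 1 + q. The product of these factors is the
  -- Poincaré polynomial of the symmetric group on four letters.
  fold₂₁ fold₂ chamber₂ fold₁ chamber₁ chamber₀ : ℕ → ℕ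
  fold₂₁   n = p n + shift 1 p n
  fold₂    n = p n + shift 1 fold₂₁ n
  chamber₂ n = p n + shift 1 fold₂ n
  fold₁    n = chamber₂ n + shift 1 chamber₂ n
  chamber₁ n = chamber₂ n + shift 1 fold₁ n
  chamber₀ n = chamber₁ n + shift 1 chamber₁ n

  private
    cancel : ∀ a b → - a +ᶻ (b +ᶻ a) ≡ b
    cancel = ring
    cancel′ : ∀ b c → c +ᶻ b +ᶻ - b ≡ c
    cancel′ = ring

    pos : ∀ {i j} → i ≡ j → 0ℤ <ᶻ i → 0ℤ <ᶻ j
    pos refl 0<i = 0<i

  counted-Fold₂₁ : Counted distance (Region Fold₂₁) fold₂₁
  counted-Fold₂₁ = counted-wall wall₁ {Chamber₃} {Chamber₃} {Fold₂₁}
    (λ (a , b , c) → a , ℤ.+-mono-< a b , b , c) (λ a (_ , b , c) → a , b , c)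
    (λ { {a , b , _} (0<a , 0<b , 0<c) → 0<a , pos (sym (cancel a b)) 0<b , ℤ.+-mono-< 0<b 0<a , 0<c })
    (λ { {a , b , _} 0<a (0<b , _ , 0<c) → 0<a , pos (cancel a b) 0<b , 0<c })
    counted-Chamber₃ counted-Chamber₃

  counted-Fold₂ : Counted distance (Region Fold₂) fold₂
  counted-Fold₂ = counted-wall wall₂ {Chamber₃} {Fold₂₁} {Fold₂}
    (λ (a , b , c) → b , a , c , ℤ.+-mono-< c b) (λ b (a , c , _) → a , b , c)
    (λ { {_ , b , c} (0<ab , 0<b , 0<c) → 0<b , 0<ab , ℤ.+-mono-< 0<c 0<b , pos (sym (cancel′ b c)) 0<c })
    (λ { {_ , b , c} 0<b (0<ab , _ , 0<c) → 0<ab , 0<b , pos (cancel′ b c) 0<c })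
    counted-Chamber₃ counted-Fold₂₁

  counted-Chamber₂ : Counted distance (Region Chamber₂) chamber₂
  counted-Chamber₂ = counted-wall wall₃ {Chamber₃} {Fold₂} {Chamber₂}
    (λ (a , b , c) → c , a , b) (λ c (a , b) → a , b , c)
    (λ { {_ , b , c} (0<a , 0<c , 0<cb) → 0<c , 0<a , pos (ℤ.+-comm c b) 0<cb })
    (λ { {_ , b , c} 0<c (0<a , 0<bc) → 0<a , 0<c , pos (ℤ.+-comm b c) 0<bc })
    counted-Chamber₃ counted-Fold₂

  counted-Fold₁ : Counted distance (Region Fold₁) fold₁
  counted-Fold₁ = counted-wall wall₁ {Chamber₂} {Chamber₂} {Fold₁}
    (λ (a , b) → a , ℤ.+-mono-< a b , b) (λ a (_ , b) → a , b)
    (λ { {a , b , _} (0<a , 0<b) → 0<a , pos (sym (cancel a b)) 0<b , ℤ.+-mono-< 0<b 0<a })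
    (λ { {a , b , _} 0<a (0<b , _) → 0<a , pos (cancel a b) 0<b })
    counted-Chamber₂ counted-Chamber₂

  counted-Chamber₁ : Counted distance (Region Chamber₁) chamber₁
  counted-Chamber₁ = counted-wall wall₂ {Chamber₂} {Fold₁} {Chamber₁}
    (λ (a , b) → b , a) (λ b a → a , b) (λ (ab , b) → b , ab) (λ b ab → ab , b)
    counted-Chamber₂ counted-Fold₁

  counted-Chamber₀ : Counted distance (Region Chamber₀) chamber₀
  counted-Chamber₀ = counted-wall wall₁ {Chamber₁} {Chamber₁} {Chamber₀}
    (λ a → a , tt) (λ a _ → a) (λ a → a , tt) (λ a _ → a)
    counted-Chamber₁ counted-Chamber₁

-- Translations of the sector

InV-translate : ∀ k x y z → InV x y z → InV x y (z +ᶻ k *ᶻ + 4)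
InV-translate k x y z (x+y , x-y , y+z , y-z , z+x , z-x) =
    x+y
  , x-y
  , ¬0mod4-translate (y +ᶻ (z +ᶻ k *ᶻ + 4)) (- k) (e₁ k y z) y+z
  , ¬0mod4-translate (y -ᶻ (z +ᶻ k *ᶻ + 4)) k     (e₂ k y z) y-z
  , ¬0mod4-translate ((z +ᶻ k *ᶻ + 4) +ᶻ x) (- k) (e₃ k x z) z+x
  , ¬0mod4-translate ((z +ᶻ k *ᶻ + 4) -ᶻ x) (- k) (e₄ k x z) z-x
  where
  e₁ : ∀ k y z → y +ᶻ z ≡ (y +ᶻ (z +ᶻ k *ᶻ + 4)) +ᶻ - k *ᶻ + 4
  e₁ = ring
  e₂ : ∀ k y z → y -ᶻ z ≡ (y -ᶻ (z +ᶻ k *ᶻ + 4)) +ᶻ k *ᶻ + 4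
  e₂ = ring
  e₃ : ∀ k x z → z +ᶻ x ≡ ((z +ᶻ k *ᶻ + 4) +ᶻ x) +ᶻ - k *ᶻ + 4
  e₃ = ring
  e₄ : ∀ k x z → z -ᶻ x ≡ ((z +ᶻ k *ᶻ + 4) -ᶻ x) +ᶻ - k *ᶻ + 4
  e₄ = ring

translate : ℤ → V → V
translate k (vertex x y z p) = vertex x y (z +ᶻ k *ᶻ + 4) (InV-translate k x y z p)

translate-inverse : ∀ k P → translate k (translate (- k) P) ≡ P
translate-inverse k (vertex x y z _) = V-≡ refl refl (e k z)
  where
  e : ∀ k z → z +ᶻ - k *ᶻ + 4 +ᶻ k *ᶻ + 4 ≡ z
  e = ring

inverse⇒injective : ∀ {A : Set} (g h : A → A) → (∀ a → h (g a) ≡ a) → ∀ {a b} → g a ≡ g b → a ≡ b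
inverse⇒injective g h inv {a} {b} eq = trans (sym (inv a)) (trans (cong h eq) (inv b))

-- Translation by (0, 4k, 4k), composed of moves already known to preserve `V`.
diagonal : ℤ → V → V
diagonal k = translate k ∘ reflect₂ ∘ translate k ∘ reflect₂

diagonal-inverse : ∀ k P → diagonal k (diagonal (- k) P) ≡ P
diagonal-inverse k (vertex x y z _) = V-≡ refl (e k y) (e k z)
  where
  e : ∀ k z → z +ᶻ - k *ᶻ + 4 +ᶻ k *ᶻ + 4 ≡ z
  e = ring

-- The number of multiples of 4 strictly between 0 and v.
above : ℤ → ℕ
above v = below (+ 4 -ᶻ v)

above-4 : ∀ {v w} → 0ℤ <ᶻ v → v +ᶻ + 4 ≡ w → above w ≡ suc (above v)
above-4 {v} 0<v refl = trans (cong below (e v)) (below-4 (ℤ.+-monoʳ-< (+ 4) (ℤ.neg-mono-< 0<v)))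
  where
  e : ∀ v → + 4 -ᶻ (v +ᶻ + 4) ≡ + 4 -ᶻ v -ᶻ + 4
  e = ring

Sector : Pred V 0ℓ
Sector (vertex x y z _) = x ≡ 0ℤ × 0ℤ <ᶻ y × 0ℤ <ᶻ z -ᶻ y

sector-z : ∀ {y z} → 0ℤ <ᶻ y → 0ℤ <ᶻ z -ᶻ y → 0ℤ <ᶻ z
sector-z {y} {z} 0<y 0<z-y = subst (0ℤ <ᶻ_) (e y z) (ℤ.+-mono-< 0<z-y 0<y)
  where
  e : ∀ y z → z -ᶻ y +ᶻ y ≡ z
  e = ring

-- With x = 0 the forms y ± x coincide, and so do z ± x. All six are positive, so separating mirrors
-- occur on the upper side only.
sector-distance : ∀ P → Sector P → let open V P in
  distance P ≡ 2 * above y + (2 * above z + (above (z +ᶻ y) + above (z -ᶻ y)))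
sector-distance P@(vertex x y z _) (refl , 0<y , 0<z-y) = begin
  inversions P + (inversions (rotate P) + (inversions (rotate² P) + (inversions (rotate³ P) + 0)))
    ≡⟨ cong₂ _+_ i₀ (cong₂ _+_ i₁ (cong₂ _+_ i₂ (cong (_+ 0) i₃))) ⟩
  above y + (above z + above (z -ᶻ y) + (above (z +ᶻ y) + (above z + above y) + 0))
    ≡⟨ e (above y) (above z) (above (z +ᶻ y)) (above (z -ᶻ y)) ⟩
  2 * above y + (2 * above z + (above (z +ᶻ y) + above (z -ᶻ y))) ∎
  where
  open ≡-Reasoning
  0<z : 0ℤ <ᶻ z
  0<z = sector-z {y} {z} 0<y 0<z-y
  vanish : ∀ {i} → 0ℤ <ᶻ i → below (i +ᶻ 0ℤ) ≡ 0
  vanish {i} 0<i = trans (cong below (ℤ.+-identityʳ i)) (below-positive 0<i)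
  above-0 : ∀ i → above (i +ᶻ 0ℤ) ≡ above i
  above-0 i = cong above (ℤ.+-identityʳ i)
  i₀ : inversions P ≡ 0
  i₀ = cong₂ _+_ (vanish 0<y) (cong₂ _+_ (vanish 0<z) (below-positive (ℤ.+-mono-< 0<z 0<y)))
  i₁ : inversions (rotate P) ≡ above y
  i₁ = trans (inversions-rotate P)
    (cong₂ _+_ (below-positive 0<z-y) (cong₂ _+_ (vanish 0<z) (above-0 y)))
  i₂ : inversions (rotate² P) ≡ above z + above (z -ᶻ y)
  i₂ = trans (inversions-rotate² P) (cong₂ _+_ (vanish 0<y) (cong (_+ above (z -ᶻ y)) (above-0 z)))
  i₃ : inversions (rotate³ P) ≡ above (z +ᶻ y) + (above z + above y)
  i₃ = trans (inversions-rotate³ P) (cong (_+_ (above (z +ᶻ y))) (cong₂ _+_ (above-0 z) (above-0 y)))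
  e : ∀ i j k l → i + (j + l + (k + (j + i) + 0)) ≡ 2 * i + (2 * j + (k + l))
  e = ringℕ

sector-translate : ∀ P → Sector P → Sector (translate (+ 1) P)
sector-translate (vertex x y z _) (refl , 0<y , 0<z-y) =
  refl , 0<y , subst (0ℤ <ᶻ_) (e y z) (ℤ.+-mono-< 0<z-y (+<+ {0} {4} (s≤s z≤n)))
  where
  e : ∀ y z → z -ᶻ y +ᶻ + 4 ≡ z +ᶻ + 4 -ᶻ y
  e = ring

sector-diagonal : ∀ P → Sector P → Sector (diagonal (+ 1) P)
sector-diagonal (vertex x y z _) (refl , 0<y , 0<z-y) =
  refl , ℤ.+-mono-< 0<y (+<+ {0} {4} (s≤s z≤n)) , subst (0ℤ <ᶻ_) (e y z) 0<z-y
  where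
  e : ∀ y z → z -ᶻ y ≡ z +ᶻ + 4 -ᶻ (y +ᶻ + 4)
  e = ring

-- The four forms z ± x and z ± y each rise by 4 and cross one more mirror.
distance-translate : ∀ P → Sector P → distance (translate (+ 1) P) ≡ 4 + distance P
distance-translate P@(vertex x y z _) s@(refl , 0<y , 0<z-y) = begin
  distance (translate (+ 1) P)
    ≡⟨ sector-distance (translate (+ 1) P) (sector-translate P s) ⟩
  2 * above y + (2 * above (z +ᶻ + 4) + (above (z +ᶻ + 4 +ᶻ y) + above (z +ᶻ + 4 -ᶻ y)))
    ≡⟨ cong (_+_ (2 * above y)) (cong₂ _+_ (cong (2 *_) (above-4 0<z refl))
         (cong₂ _+_ (above-4 (ℤ.+-mono-< 0<z 0<y) (e₁ y z)) (above-4 0<z-y (e₂ y z)))) ⟩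
  2 * above y + (2 * suc (above z) + (suc (above (z +ᶻ y)) + suc (above (z -ᶻ y))))
    ≡⟨ e (above y) (above z) (above (z +ᶻ y)) (above (z -ᶻ y)) ⟩
  4 + (2 * above y + (2 * above z + (above (z +ᶻ y) + above (z -ᶻ y))))
    ≡⟨ cong (_+_ 4) (sector-distance P s) ⟨
  4 + distance P ∎
  where
  open ≡-Reasoning
  0<z = sector-z {y} {z} 0<y 0<z-y
  e : ∀ i j k l → 2 * i + (2 * suc j + (suc k + suc l)) ≡ 4 + (2 * i + (2 * j + (k + l)))
  e = ringℕ
  e₁ : ∀ y z → z +ᶻ y +ᶻ + 4 ≡ z +ᶻ + 4 +ᶻ y
  e₁ = ring
  e₂ : ∀ y z → z -ᶻ y +ᶻ + 4 ≡ z +ᶻ + 4 -ᶻ y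
  e₂ = ring

-- The forms y ± x and z ± x rise by 4, z + y rises by 8 and z - y is unchanged: 4 + 2 new mirrors.
distance-diagonal : ∀ P → Sector P → distance (diagonal (+ 1) P) ≡ 6 + distance P
distance-diagonal P@(vertex x y z _) s@(refl , 0<y , 0<z-y) = begin
  distance (diagonal (+ 1) P)
    ≡⟨ sector-distance (diagonal (+ 1) P) (sector-diagonal P s) ⟩
  2 * above (y +ᶻ + 4) + (2 * above (z +ᶻ + 4) +
    (above (z +ᶻ + 4 +ᶻ (y +ᶻ + 4)) + above (z +ᶻ + 4 -ᶻ (y +ᶻ + 4))))
    ≡⟨ cong₂ _+_ (cong (2 *_) (above-4 0<y refl)) (cong₂ _+_ (cong (2 *_) (above-4 0<z refl))
         (cong₂ _+_ (trans (above-4 0<z+y+4 (e₁ y z)) (cong suc (above-4 0<z+y refl))) (cong above (e₂ y z)))) ⟩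
  2 * suc (above y) + (2 * suc (above z) + (suc (suc (above (z +ᶻ y))) + above (z -ᶻ y)))
    ≡⟨ e (above y) (above z) (above (z +ᶻ y)) (above (z -ᶻ y)) ⟩
  6 + (2 * above y + (2 * above z + (above (z +ᶻ y) + above (z -ᶻ y))))
    ≡⟨ cong (_+_ 6) (sector-distance P s) ⟨
  6 + distance P ∎
  where
  open ≡-Reasoning
  0<z = sector-z {y} {z} 0<y 0<z-y
  0<z+y = ℤ.+-mono-< 0<z 0<y
  0<z+y+4 = ℤ.+-mono-< 0<z+y (+<+ {0} {4} (s≤s z≤n))
  e : ∀ i j k l → 2 * suc i + (2 * suc j + (suc (suc k) + l)) ≡ 6 + (2 * i + (2 * j + (k + l)))
  e = ringℕ
  e₁ : ∀ y z → z +ᶻ y +ᶻ + 4 +ᶻ + 4 ≡ z +ᶻ + 4 +ᶻ (y +ᶻ + 4)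
  e₁ = ring
  e₂ : ∀ y z → z +ᶻ + 4 -ᶻ (y +ᶻ + 4) ≡ z -ᶻ y
  e₂ = ring

-- What remains of `Sector` when its image under `diagonal (+ 1)` is removed, and of `Band` when its
-- image under `translate (+ 1)` is removed.
Band Base : Pred V 0ℓ
Band P = Sector P × V.y P <ᶻ + 4
Base P = Band P × V.z P -ᶻ V.y P <ᶻ + 4

4-or-more : ∀ {v} → ¬ ≡0mod4 v → v <ᶻ + 4 ⊎ 0ℤ <ᶻ v +ᶻ - + 1 *ᶻ + 4
4-or-more {v} ¬4∣v with ℤ.<-cmp v (+ 4)
... | tri< v<4 _ _ = inj₁ v<4
... | tri≈ _ refl _ = contradiction (divides 1 refl) ¬4∣v
... | tri> _ _ 4<v = inj₂ (ℤ.+-monoˡ-< -[1+ 3 ] 4<v)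

¬v+4<4 : ∀ {v} → 0ℤ <ᶻ v → ¬ v +ᶻ + 4 <ᶻ + 4
¬v+4<4 0<v v+4<4 = ℤ.<-asym v+4<4 (ℤ.+-monoˡ-< (+ 4) 0<v)

sector-split : Splits distance Sector Band distance (diagonal (+ 1)) Sector 6
sector-split = record
  { injective = inverse⇒injective (diagonal (+ 1)) (diagonal -[1+ 0 ]) (diagonal-inverse -[1+ 0 ])
  ; weight    = λ {P} → distance-diagonal P
  ; sound     = λ { (inj₁ (s , _)) → s ; (inj₂ (P , s , refl)) → sector-diagonal P s }
  ; complete  = λ {P} → complete P
  ; disjoint  = λ { (_ , 0<y , _) (_ , y<4) → ¬v+4<4 0<y y<4 }
  }
  where
  complete : ∀ P → Sector P → Band P ⊎ Image (diagonal (+ 1)) Sector P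
  complete P@(vertex x y z p) s@(refl , 0<y , 0<z-y)
    with 4-or-more {y} (λ d → ⊥-elim-irr (proj₁ p (subst ≡0mod4 (sym (ℤ.+-identityˡ y)) d)))
  ... | inj₁ y<4 = inj₁ (s , y<4)
  ... | inj₂ 0<y-4 = inj₂
    (diagonal (- + 1) P , (refl , 0<y-4 , subst (0ℤ <ᶻ_) (e y z) 0<z-y) , diagonal-inverse (+ 1) P)
    where
    e : ∀ y z → z -ᶻ y ≡ z +ᶻ - + 4 -ᶻ (y +ᶻ - + 4)
    e = ring

band-split : Splits distance Band Base distance (translate (+ 1)) Band 4
band-split = record
  { injective = inverse⇒injective (translate (+ 1)) (translate -[1+ 0 ]) (translate-inverse -[1+ 0 ])
  ; weight    = λ {P} (s , _) → distance-translate P s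
  ; sound     = λ { (inj₁ (b , _)) → b ; (inj₂ (P , (s , y<4) , refl)) → sector-translate P s , y<4 }
  ; complete  = λ {P} → complete P
  ; disjoint  = λ { {vertex x y z _} ((_ , _ , 0<z-y) , _) (_ , lt) → ¬v+4<4 0<z-y (subst (_<ᶻ + 4) (e y z) lt) }
  }
  where
  e : ∀ y z → z +ᶻ + 4 -ᶻ y ≡ z -ᶻ y +ᶻ + 4
  e = ring
  complete : ∀ P → Band P → Base P ⊎ Image (translate (+ 1)) Band P
  complete P@(vertex x y z p) b@((refl , 0<y , 0<z-y) , y<4)
    with 4-or-more {z -ᶻ y} (λ d → ⊥-elim-irr (¬0mod4---comm y z (proj₁ (proj₂ (proj₂ (proj₂ p)))) d))
  ... | inj₁ lt = inj₁ (b , lt)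
  ... | inj₂ gt = inj₂
    (translate (- + 1) P , ((refl , 0<y , subst (0ℤ <ᶻ_) (e′ y z) gt) , y<4) , translate-inverse (+ 1) P)
    where
    e′ : ∀ y z → z -ᶻ y +ᶻ - + 4 ≡ z +ᶻ - + 4 -ᶻ y
    e′ = ring

-- The indices are the distances from `O`.
O₁ O₃ O₄ : V
O₁ = vertex (+ 0) (+ 2) (+ 3)
  (from-no (4 ∣? 2) , from-no (4 ∣? 2) , from-no (4 ∣? 5) , from-no (4 ∣? 1) , from-no (4 ∣? 3) , from-no (4 ∣? 3))
O₃ = vertex (+ 0) (+ 2) (+ 5)
  (from-no (4 ∣? 2) , from-no (4 ∣? 2) , from-no (4 ∣? 7) , from-no (4 ∣? 3) , from-no (4 ∣? 5) , from-no (4 ∣? 5))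
O₄ = vertex (+ 0) (+ 3) (+ 6)
  (from-no (4 ∣? 3) , from-no (4 ∣? 3) , from-no (4 ∣? 9) , from-no (4 ∣? 3) , from-no (4 ∣? 6) , from-no (4 ∣? 6))

data OneToThree : ℤ → Set where
  one   : OneToThree (+ 1)
  two   : OneToThree (+ 2)
  three : OneToThree (+ 3)

oneToThree : ∀ {v} → 0ℤ <ᶻ v → v <ᶻ + 4 → OneToThree v
oneToThree {+ 1} _ _ = one
oneToThree {+ 2} _ _ = two
oneToThree {+ 3} _ _ = three
oneToThree {+ 0} (+<+ ()) _
oneToThree {+ suc (suc (suc (suc v)))} _ (+<+ (s≤s (s≤s (s≤s (s≤s ())))))

base-points : Base ≐ (O ≡_) ∪ ((O₁ ≡_) ∪ ((O₃ ≡_) ∪ (O₄ ≡_)))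
base-points = (λ {P} → list P) , λ where
    (inj₁ refl)               → ((refl , +<+ (s≤s z≤n) , +<+ (s≤s z≤n)) , 1<4) , 1<4
    (inj₂ (inj₁ refl))        → ((refl , +<+ (s≤s z≤n) , +<+ (s≤s z≤n)) , 2<4) , 1<4
    (inj₂ (inj₂ (inj₁ refl))) → ((refl , +<+ (s≤s z≤n) , +<+ (s≤s z≤n)) , 2<4) , 3<4
    (inj₂ (inj₂ (inj₂ refl))) → ((refl , +<+ (s≤s z≤n) , +<+ (s≤s z≤n)) , 3<4) , 3<4
  where
  3<4 : + 3 <ᶻ + 4
  3<4 = +<+ (s≤s (s≤s (s≤s (s≤s z≤n))))
  2<4 : + 2 <ᶻ + 4
  2<4 = +<+ (s≤s (s≤s (s≤s z≤n)))
  1<4 : + 1 <ᶻ + 4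
  1<4 = +<+ (s≤s (s≤s z≤n))
  split-z : ∀ y z → z ≡ y +ᶻ (z -ᶻ y)
  split-z = ring
  points : ∀ {y w} → OneToThree y → OneToThree w → ∀ z → z ≡ y +ᶻ w → .(p : InV (+ 0) y z) →
           ((O ≡_) ∪ ((O₁ ≡_) ∪ ((O₃ ≡_) ∪ (O₄ ≡_)))) (vertex (+ 0) y z p)
  -- Of the nine pairs (y, z - y), five make z + y or z ± x a multiple of 4.
  points one   one   _ refl p = inj₁ refl
  points one   two   _ refl p = ⊥-elim-irr (proj₁ (proj₂ (proj₂ p)) (divides 1 refl))
  points one   three _ refl p = ⊥-elim-irr (proj₁ (proj₂ (proj₂ (proj₂ (proj₂ p)))) (divides 1 refl))
  points two   one   _ refl p = inj₂ (inj₁ refl)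
  points two   two   _ refl p = ⊥-elim-irr (proj₁ (proj₂ (proj₂ (proj₂ (proj₂ p)))) (divides 1 refl))
  points two   three _ refl p = inj₂ (inj₂ (inj₁ refl))
  points three one   _ refl p = ⊥-elim-irr (proj₁ (proj₂ (proj₂ (proj₂ (proj₂ p)))) (divides 1 refl))
  points three two   _ refl p = ⊥-elim-irr (proj₁ (proj₂ (proj₂ p)) (divides 2 refl))
  points three three _ refl p = inj₂ (inj₂ (inj₂ refl))
  list : ∀ P → Base P → ((O ≡_) ∪ ((O₁ ≡_) ∪ ((O₃ ≡_) ∪ (O₄ ≡_)))) P
  list (vertex x y z p) (((refl , 0<y , 0<z-y) , y<4) , z-y<4) =
    points (oneToThree 0<y y<4) (oneToThree 0<z-y z-y<4) z (split-z y z) p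

-- The series 1 + q + q³ + q⁴, its quotient by 1 - q⁴, and the quotient of that by 1 - q⁶.
base band sector : ℕ → ℕ
base n = shift 0 δ n + (shift 1 δ n + (shift 3 δ n + shift 4 δ n))
band (suc (suc (suc (suc n)))) = base (4 + n) + band n
band n                         = base n
sector (suc (suc (suc (suc (suc (suc n)))))) = band (6 + n) + sector n
sector n                                     = band n

counted-base : Counted distance Base base
counted-base = counted-resp (swap base-points) (λ _ → refl)
  (counted-∪ (λ { refl (inj₂ (inj₁ ())) ; refl (inj₂ (inj₂ ())) ; refl (inj₁ ()) }) counted-singleton
  (counted-∪ (λ { refl (inj₁ ()) ; refl (inj₂ ()) }) counted-singleton
  (counted-∪ (λ { refl () }) counted-singleton counted-singleton)))

counted-band : Counted distance Band band
counted-band = counted-rec band-split counted-base λ where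
  0 → refl
  1 → refl
  2 → refl
  3 → refl
  (suc (suc (suc (suc n)))) → refl

counted-sector : Counted distance Sector sector
counted-sector = counted-rec sector-split counted-band λ where
  0 → refl
  1 → refl
  2 → refl
  3 → refl
  4 → refl
  5 → refl
  (suc (suc (suc (suc (suc (suc n)))))) → refl

-- The sum of y + x > 0 and y - x > 0 gives y > 0, and z > y then gives z > 0; so xyz = 0 forces x =
-- 0.
sector-chamber : Sector ≐ Region Chamber₃
sector-chamber = (λ {P} → sound P) , (λ {P} → complete P)
  where
  sound : ∀ P → Sector P → Region Chamber₃ P
  sound (vertex x y z _) (refl , 0<y , 0<z-y) =
    refl , subst (0ℤ <ᶻ_) (sym (ℤ.+-identityʳ y)) 0<y , 0<z-y , subst (0ℤ <ᶻ_) (sym (ℤ.+-identityʳ y)) 0<y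

  positive-half : ∀ {i} → 0ℤ <ᶻ i +ᶻ i → 0ℤ <ᶻ i
  positive-half {+ suc i} _ = +<+ (s≤s z≤n)
  positive-half {+ zero} (+<+ ())
  positive-half { -[1+ i ]} ()

  e : ∀ x y → (y +ᶻ x) +ᶻ (y -ᶻ x) ≡ y +ᶻ y
  e = ring

  complete : ∀ P → Region Chamber₃ P → Sector P
  complete (vertex x y z _) (pl , 0<a , 0<b , 0<c) = x≡0 (ℤ.i*j≡0⇒i≡0∨j≡0 (x *ᶻ y) pl) , 0<y , 0<b
    where
    0<y = positive-half (subst (0ℤ <ᶻ_) (e x y) (ℤ.+-mono-< 0<a 0<c))
    x≡0 : x *ᶻ y ≡ 0ℤ ⊎ z ≡ 0ℤ → x ≡ 0ℤ
    x≡0 (inj₂ z≡0) = contradiction (sym z≡0) (ℤ.<⇒≢ (sector-z {y} {z} 0<y 0<b))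
    x≡0 (inj₁ xy≡0) with ℤ.i*j≡0⇒i≡0∨j≡0 x xy≡0
    ... | inj₁ x≡0 = x≡0
    ... | inj₂ y≡0 = contradiction (sym y≡0) (ℤ.<⇒≢ 0<y)

counted-sector-chamber : Counted distance (Region Chamber₃) sector
counted-sector-chamber = counted-resp sector-chamber (λ _ → refl) counted-sector

-- Closed form of the planar count

wedge planar : ℕ → ℕ
wedge  = chamber₂ counted-sector-chamber
planar = chamber₀ counted-sector-chamber

-- Beyond degree 4 `base` vanishes and `band` has period 4; its sum over a period is the number of
-- base points.
band-period : ∀ n → band (9 + n) + (band (8 + n) + (band (7 + n) + band (6 + n))) ≡ 4
band-period zero    = refl
band-period (suc n) = trans (e (band (6 + n)) (band (9 + n)) (band (8 + n)) (band (7 + n))) (band-period n)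
  where
  e : ∀ i j k l → i + (j + (k + l)) ≡ j + (k + (l + i))
  e = ringℕ

wedge-period : ∀ n → wedge (6 + n) ≡ 4 + wedge n
wedge-period 0 = refl
wedge-period 1 = refl
wedge-period 2 = refl
wedge-period (suc (suc (suc n))) = trans
  (e (band (9 + n)) (band (8 + n)) (band (7 + n)) (band (6 + n))
     (sector (3 + n)) (sector (2 + n)) (sector (1 + n)) (sector n))
  (cong (_+ wedge (3 + n)) (band-period n))
  where
  e : ∀ i j k l p q r s → (i + p) + ((j + q) + ((k + r) + (l + s))) ≡ (i + (j + (k + l))) + (p + (q + (r + s)))
  e = ringℕ

planar-period : ∀ n → planar (9 + n) ≡ 24 + planar (3 + n)
planar-period n = trans
  (cong₂ _+_ (cong₂ _+_ w₃ (cong₂ _+_ w₂ w₁)) (cong₂ _+_ w₂ (cong₂ _+_ w₁ (wedge-period n))))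
  (e (wedge (3 + n)) (wedge (2 + n)) (wedge (1 + n)) (wedge n))
  where
  w₁ = wedge-period (1 + n)
  w₂ = wedge-period (2 + n)
  w₃ = wedge-period (3 + n)
  e : ∀ i j k l → (4 + i + (4 + j + (4 + k))) + (4 + j + (4 + k + (4 + l))) ≡ 24 + ((i + (j + k)) + (j + (k + l)))
  e = ringℕ

planar-formula : ∀ n → n > 0 → planar n ≡ 4 * n
planar-formula (suc n) _ = go n
  where
  e : ∀ m → 24 + 4 * (3 + m) ≡ 4 * (9 + m)
  e = ringℕ
  go : ∀ n → planar (suc n) ≡ 4 * suc n
  go 0 = refl
  go 1 = refl
  go 2 = refl
  go 3 = refl
  go 4 = refl
  go 5 = refl
  go 6 = refl
  go 7 = refl
  go (suc (suc (suc (suc (suc (suc (suc (suc m)))))))) =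
    trans (planar-period m) (trans (cong (_+_ 24) (go (suc (suc m)))) (e m))

planarSphere-cardinality : ∀ n → HasCardinality (PlanarSphere n) (planar n)
planarSphere-cardinality n = card-resp
  ((λ { ((pl , _) , d) → proj₁ (sphere n) d , pl }) , (λ { (s , pl) → (pl , _) , proj₂ (sphere n) s }))
  (counted-Chamber₀ counted-sector-chamber n)

theorem2 : (HasCardinality (PlanarSphere 0) 1 ×
    (∀ n → n > 0 → HasCardinality (PlanarSphere n) (4 * n))) ×
    (HasCardinality (Sphere 0) 1 ×
    (∀ n → n > 0 → HasCardinality (Sphere n) (2 * (n ^ 2 + 1))))
theorem2 =
  ( planarSphere-cardinality 0
  , λ n n>0 → subst (HasCardinality (PlanarSphere n)) (planar-formula n n>0) (planarSphere-cardinality n) ) ,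
  ( sphere-cardinality 0
  , λ n n>0 → subst (HasCardinality (Sphere n)) (coordination-formula n n>0) (sphere-cardinality n) )
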